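{- Suppose the algorithm FOREST-DENSE (described in the context) is run with a bicriteria $(O(\log|V|),4)$-approximation algorithm for Group Steiner Orienteering on tree metrics with vertex set $V$. Then there is a constant $A>0$ (depending only on the constant hidden in this $O(\log|V|)$) such that for every instance of Precedence-Constrained Parallel Densest Subfamily (PCPDS) with identical machines, out-forest precedence constraints and $k\ge2$ sets, FOREST-DENSE returns a precedence-closed assignment $\mathcal{F}$ such that $$\Delta(\mathcal{F}^*,\mathcal{U})\le A\cdot\log k\cdot\Delta(\mathcal{F},\mathcal{U}),$$ where $\mathcal{F}^*$ is an optimal (maximum density) precedence-closed assignment of sets to machines.
   Context: Notation: $\mathbb{N}=\{1,2,\dots\}$ and $[m]=\{1,\dots,m\}$. PCPDS instance with identical machines and out-forest constraints: a finite universe $\mathcal{U}$, a collection $\mathcal{S}$ of $k$ subsets of $\mathcal{U}$ with $\bigcup_{S\in\mathcal{S}}S=\mathcal{U}$, a number $m\ge1$ of machines, costs $c:\mathcal{S}\to\mathbb{N}$ (the processing time of $S$ on every machine), weights $w:\mathcal{U}\to\mathbb{N}$, and a directed acyclic graph on $\mathcal{S}$ in which each set has at most one direct predecessor (a collection of trees directed from root to leaves). If there is a directed path from $S_1$ to $S_2$, then $S_1$ is a predecessor of $S_2$ and must be completed before $S_2$ is started. An assignment $\mathcal{F}$ schedules some (at least one) of the sets non-preemptively on the $m$ machines, each scheduled set $S$ being processed once, on one machine, for $c(S)$ time units, with each machine processing at most one set at a time (machines may idle). It is precedence-closed if for every scheduled set all its predecessors are scheduled and completed before it starts. Its length $|\mathcal{F}|$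 is the time at which the last scheduled set is completed. With $\operatorname{cov}(\mathcal{F},\mathcal{U})$ the union of all scheduled sets and $w(\mathcal{U}')=\sum_{u\in\mathcal{U}'}w(u)$, the density is $\Delta(\mathcal{F},\mathcal{U})=w(\operatorname{cov}(\mathcal{F},\mathcal{U}))/|\mathcal{F}|$. PCPDS asks for a precedence-closed assignment of maximum density. Group Steiner Orienteering (GSO): given a metric $(V,d)$, a root $r\in V$, groups $X_1,\dots,X_g\subseteq V$ with weights, and a budget $K$, find an $r$-tour $(r=u_0,u_1,\dots,u_q=r)$ of length $\sum_{i=1}^q d(u_{i-1},u_i)\le K$ maximizing the total weight of covered groups (a group is covered if the tour visits one of its vertices). An $(a,b)$-approximation algorithm returns an $r$-tour of length at most $a\cdot K$ covering at least a $1/b$ fraction of the weight covered by an optimal tour of length at most $K$. On a tree metric, tours are regarded as closed walks along tree edges, so that a tour visits all vertices on the tree paths it traverses. List-Scheduling of a predecessor-closed family: starting from time $0$, whenever a machine is idle and there is an unscheduled set of the family all of whose predecessors are completed, start such a set on that machine. Algorithm FOREST-DENSE. Build the rooted edge-weighted tree $T$ with vertex set $\mathcal{S}\cup\{r\}$: the parent of $S\in\mathcal{S}$ is its direct predecessor if it has one, and $r$ otherwise; the edge from $S$ to its parent has length $c(S)$; $d$ is the path metric of $T$. For each $u\in\mathcal{U}$ create a group $X_u=\{S\in\mathcal{S}:u\in S\}$ of weight $w(u)$. For each budget $B$ among consecutive powers of $2$ (up to an upper bound on the length of any schedule that does not idle unnecessarily, e.g. up to the first power of $2$ that is at least $m\sum_{S\in\mathcal{S}}c(S)$):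 temporarily remove from $T$ all vertices $S$ with $d(r,S)>B$; run the GSO algorithm on the remaining tree with the groups restricted to it and budget $K=2m\cdot B$ to obtain a tour; let $\mathcal{C}$ be the collection of sets visited by the tour; List-Schedule $\mathcal{C}$ on the $m$ machines to obtain an assignment $\mathcal{F}_B$ (values of $B$ with $\mathcal{C}=\emptyset$ are ignored). Return an $\mathcal{F}_B$ of maximum density.
   Formalization: The starting times of the sets in an assignment are rational rather than real numbers; since costs are natural numbers, rounding starting times down to integers keeps an assignment feasible and no longer, so the maximum density is unaffected. -}

module Defs where

open import Level using (0ℓ)
open import Algebra.Properties.CommutativeMonoid.Sum using ()
open import Data.Bool using (if_then_else_)
open import Data.Fin using (Fin; zero; suc; toℕ)
open import Data.Fin.Induction using (spo-wellFounded)
open import Data.Fin.Subset using (Subset; inside; outside; _∈_; _⊆_; _∩_; _∪_; ⁅_⁆; ⋃; ∣_∣; Nonempty)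
open import Data.Fin.Subset.Properties using (_∈?_; nonempty?; p∩q⊆q)
open import Data.Integer using (+_)
open import Data.List using (List; filter; allFin; map)
open import Data.List.Membership.Propositional.Properties using (∈-allFin; ∈-filter⁺; ∈-map⁺)
import Data.List.Relation.Unary.All as All
open import Data.Maybe using (Maybe; just; nothing; maybe)
open import Data.Nat using (ℕ; suc; _+_; _*_; _^_; _≤_; _<_; _≤?_; >-nonZero)
import Data.Nat.Properties as ℕ
open import Data.Nat.Logarithm using (⌈log₂_⌉)
open import Data.Product using (∃-syntax; Σ-syntax; _×_; _,_)
open import Data.Rational using (ℚ; 0ℚ)
import Data.Rational as ℚ
import Data.Rational.Properties as ℚ
open import Relation.Binary using (Rel; IsStrictPartialOrder; DecTotalOrder)
open import Data.List.Extrema (DecTotalOrder.totalOrder ℚ.≤-decTotalOrder) using (max; xs≤max)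
open import Data.Sum using (_⊎_)
open import Data.Vec using (_∷_; here; there; lookup; tabulate; tail)
open import Data.Vec.Properties using ([]=⇒lookup; lookup⇒[]=; lookup∘tabulate)
open import Induction.WellFounded using (WellFounded; Acc; acc)
open import Relation.Binary.Construct.Closure.ReflexiveTransitive using (Star; ε; _◅_)
open import Relation.Binary.Construct.Closure.Transitive using (TransClosure; [_]; transitive; wellFounded⁻)
open import Relation.Binary.PropositionalEquality using (_≡_; _≢_; refl; sym; trans; isEquivalence; resp₂)
open import Relation.Nullary using (¬_; Dec; does; yes; no)
open import Relation.Nullary.Decidable using (dec-true)

open Algebra.Properties.CommutativeMonoid.Sum ℕ.+-0-commutativeMonoid using (sum; sum-syntax)

fromℕ : ℕ → ℚ
fromℕ n = + n ℚ./ 1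

weight : ∀ {n} → (Fin n → ℕ) → Subset n → ℕ
weight {n} w p = ∑[ i < n ] (if lookup p i then w i else 0)

elements : ∀ {n} → Subset n → List (Fin n)
elements {n} p = filter (_∈? p) (allFin n)

subset : ∀ {n} {P : Fin n → Set} → (∀ i → Dec (P i)) → Subset n
subset P? = tabulate (λ i → does (P? i))

∈-subset⁺ : ∀ {n} {P : Fin n → Set} (P? : ∀ i → Dec (P i)) {i} → P i → i ∈ subset P?
∈-subset⁺ P? {i} pi =
  lookup⇒[]= i _ (trans (lookup∘tabulate _ i) (dec-true (P? i) pi))

∈-subset⁻ : ∀ {n} {P : Fin n → Set} (P? : ∀ i → Dec (P i)) {i} → i ∈ subset P? → P i
∈-subset⁻ P? {i} i∈ with P? i | trans (sym (lookup∘tabulate (λ j → does (P? j)) i)) ([]=⇒lookup i∈)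
... | yes pi | _  = pi
... | no _   | ()

------------------------------------------------------------------------
-- Out-forests and rooted trees

record OutForest (k : ℕ) : Set where
  field
    directPred : Fin k → Maybe (Fin k)

  _≺₁_ : Rel (Fin k) 0ℓ
  P ≺₁ S = directPred S ≡ just P

  _≺_ : Rel (Fin k) 0ℓ
  _≺_ = TransClosure _≺₁_

  field
    acyclic : ∀ S → ¬ (S ≺ S)

  ≺₁-wellFounded : WellFounded _≺₁_
  ≺₁-wellFounded = wellFounded⁻ _≺₁_ (spo-wellFounded ≺-isSPO)
    where
    ≺-isSPO : IsStrictPartialOrder _≡_ _≺_
    ≺-isSPO = record
      { isEquivalence = isEquivalence
      ; irrefl        = λ { {S} refl S≺S → acyclic S S≺S }
      ; trans         = transitive _≺₁_
      ; <-resp-≈      = resp₂ _≺_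
      }

-- An extra root r is put above all roots of an out-forest on Fin k.
-- The vertex set is Fin (suc k): r is zero, the forest vertex S is suc S,
-- and every edge is identified with its lower endpoint S.
record RootedTree (k : ℕ) : Set where
  field
    forest       : OutForest k
    edgeLength   : Fin k → ℕ
    edgeLength>0 : ∀ S → 0 < edgeLength S

  open OutForest forest public

  parent : Fin k → Fin (suc k)
  parent S = maybe suc zero (directPred S)

  distAcc : ∀ S → Acc _≺₁_ S → ℕ
  distAcc S (acc rs) with directPred S
  ... | nothing = edgeLength S
  ... | just P  = edgeLength S + distAcc P (rs refl)

  -- d(r, S)
  rootDist : Fin k → ℕ
  rootDist S = distAcc S (≺₁-wellFounded S)

  distAcc-irrelevant : ∀ S (a b : Acc _≺₁_ S) → distAcc S a ≡ distAcc S b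
  distAcc-irrelevant S (acc rs) (acc rs′) with directPred S
  ... | nothing = refl
  ... | just P  rewrite distAcc-irrelevant P (rs refl) (rs′ refl) = refl

  distAcc-mono : ∀ {P} S → P ≺₁ S → (a : Acc _≺₁_ S) (b : Acc _≺₁_ P) →
                 distAcc P b ≤ distAcc S a
  distAcc-mono S P≺S (acc rs) b with directPred S
  distAcc-mono S refl (acc rs) b | just P
    rewrite distAcc-irrelevant P b (rs refl) = ℕ.m≤n+m _ (edgeLength S)

  within : ℕ → Subset (suc k)
  within B = inside ∷ subset (λ S → rootDist S ≤? B)

  within-parent : ∀ {B} S → suc S ∈ within B → parent S ∈ within B
  within-parent {B} S (there S∈) with directPred S in eq
  ... | nothing = here
  ... | just P  = there (∈-subset⁺ (λ S → rootDist S ≤? B)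
                    (ℕ.≤-trans (distAcc-mono S eq (≺₁-wellFounded S) (≺₁-wellFounded P))
                               (∈-subset⁻ (λ S → rootDist S ≤? B) S∈)))

------------------------------------------------------------------------
-- Group Steiner Orienteering on tree metrics

-- The metric space is the subtree of the ambient tree induced by V.
record GSOInstance (k g : ℕ) : Set where
  field
    tree          : RootedTree k
    V             : Subset (suc k)

  open RootedTree tree public

  field
    root∈V        : zero ∈ V
    parent-closed : ∀ S → suc S ∈ V → parent S ∈ V
    group         : Fin g → Subset (suc k)
    group⊆V       : ∀ i → group i ⊆ V
    groupWeight   : Fin g → ℕ
    budget        : ℕ

  data Edge : Rel (Fin (suc k)) 0ℓ where
    up   : ∀ {S v} → suc S ∈ V → parent S ≡ v → Edge (suc S) v
    down : ∀ {S v} → suc S ∈ V → parent S ≡ v → Edge v (suc S)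

  Tour : Set
  Tour = Star Edge zero zero

  stepLength : ∀ {u v} → Edge u v → ℕ
  stepLength (up   {S} _ _) = edgeLength S
  stepLength (down {S} _ _) = edgeLength S

  walkLength : ∀ {u v} → Star Edge u v → ℕ
  walkLength ε        = 0
  walkLength (e ◅ es) = stepLength e + walkLength es

  visited : ∀ {u v} → Star Edge u v → Subset (suc k)
  visited {u} ε        = ⁅ u ⁆
  visited {u} (e ◅ es) = ⁅ u ⁆ ∪ visited es

  coveredGroups : Tour → Subset g
  coveredGroups τ = subset (λ i → nonempty? (group i ∩ visited τ))

  coveredWeight : Tour → ℕ
  coveredWeight τ = weight groupWeight (coveredGroups τ)

  IsOptimalTour : Tour → Set
  IsOptimalTour τ* = walkLength τ* ≤ budget
    × (∀ τ → walkLength τ ≤ budget → coveredWeight τ ≤ coveredWeight τ*)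

GSOAlgorithm : Set
GSOAlgorithm = ∀ {k g} (G : GSOInstance k g) → GSOInstance.Tour G

-- The factor a of the tour length may depend on the number of vertices.
IsBicriteriaApproximation : (ℕ → ℕ) → ℕ → GSOAlgorithm → Set
IsBicriteriaApproximation a b gso = ∀ {k g} (G : GSOInstance k g) →
  let open GSOInstance G in
    walkLength (gso G) ≤ a ∣ V ∣ * budget
  × (∀ τ* → IsOptimalTour τ* → coveredWeight τ* ≤ b * coveredWeight (gso G))

------------------------------------------------------------------------
-- PCPDS with identical machines and out-forest constraints

-- The subsets form an indexed family, so repetitions are allowed.  For
-- k ≥ 2 distinct sets, non-emptiness of the universe is automatic; for
-- repeated empty sets it is not, and then no tour need visit any set.
record PCPDS (k : ℕ) : Set where
  field
    n           : ℕ
    n>0         : 0 < n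
    set         : Fin k → Subset n
    set-covers  : ∀ u → ∃[ S ] u ∈ set S
    m           : ℕ
    m>0         : 0 < m
    cost        : Fin k → ℕ
    cost>0      : ∀ S → 0 < cost S
    w           : Fin n → ℕ
    w>0         : ∀ u → 0 < w u
    precedence  : OutForest k

  open OutForest precedence public using (_≺_)

  totalCost : ℕ
  totalCost = ∑[ S < k ] cost S

  -- The values of machine and start on unscheduled sets are irrelevant.
  record Assignment : Set where
    field
      scheduled : Subset k
      nonempty  : Nonempty scheduled
      machine   : Fin k → Fin m
      start     : Fin k → ℚ
      start≥0   : ∀ {S} → S ∈ scheduled → 0ℚ ℚ.≤ start S

    finish : Fin k → ℚ
    finish S = start S ℚ.+ fromℕ (cost S)

    field
      no-overlap : ∀ {S₁ S₂} → S₁ ∈ scheduled → S₂ ∈ scheduled → S₁ ≢ S₂ →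
                   machine S₁ ≡ machine S₂ →
                   finish S₁ ℚ.≤ start S₂ ⊎ finish S₂ ℚ.≤ start S₁

    length : ℚ
    length = max 0ℚ (map finish (elements scheduled))

    finish≤length : ∀ {S} → S ∈ scheduled → finish S ℚ.≤ length
    finish≤length {S} S∈ = All.lookup (xs≤max 0ℚ (map finish (elements scheduled)))
      (∈-map⁺ finish (∈-filter⁺ (_∈? scheduled) (∈-allFin S) S∈))

    length>0 : 0ℚ ℚ.< length
    length>0 with nonempty
    ... | S , S∈ = ℚ.<-≤-trans
      (ℚ.+-mono-≤-< (start≥0 S∈)
        (ℚ.positive⁻¹ _ {{ℚ.normalize-pos (cost S) 1 {{_}} {{>-nonZero (cost>0 S)}}}}))
      (finish≤length S∈)

    length-nonZero : ℚ.NonZero length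
    length-nonZero = ℚ.pos⇒nonZero length {{ℚ.positive length>0}}

    cov : Subset n
    cov = ⋃ (map set (elements scheduled))

    density : ℚ
    density = (fromℕ (weight w cov) ℚ.÷ length) {{length-nonZero}}

    Idle : Fin m → ℚ → Set
    Idle p t = ¬ (∃[ S ] S ∈ scheduled × machine S ≡ p × start S ℚ.≤ t × t ℚ.< finish S)

  open Assignment public using (density)

  IsPrecedenceClosed : Assignment → Set
  IsPrecedenceClosed F = ∀ {P S} → S ∈ scheduled → P ≺ S →
                         P ∈ scheduled × finish P ℚ.≤ start S
    where open Assignment F

  IsOptimal : Assignment → Set
  IsOptimal F* = IsPrecedenceClosed F*
    × (∀ F → IsPrecedenceClosed F → density F ℚ.≤ density F*)

  -- F is a possible outcome of List-Scheduling the family 𝒞: sets are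
  -- started only when their predecessors are completed, and at no time t is
  -- a machine idle while some set of 𝒞 that has not been started by time t
  -- has all its predecessors completed.  Ties are broken arbitrarily.
  record IsListSchedule (𝒞 : Subset k) (F : Assignment) : Set where
    open Assignment F

    Available : Fin k → ℚ → Set
    Available S t = ∀ {P} → P ≺ S → P ∈ scheduled × finish P ℚ.≤ t

    field
      family : scheduled ≡ 𝒞
      ready  : ∀ {S} → S ∈ 𝒞 → Available S (start S)
      greedy : ∀ {S p t} → 0ℚ ℚ.≤ t → Idle p t → S ∈ 𝒞 → Available S t →
               start S ℚ.≤ t

------------------------------------------------------------------------
-- FOREST-DENSE

module ForestDense (gso : GSOAlgorithm) {k : ℕ} (I : PCPDS k) where
  open PCPDS I

  T : RootedTree k
  T = record { forest = precedence ; edgeLength = cost ; edgeLength>0 = cost>0 }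

  X : Fin n → Subset (suc k)
  X u = outside ∷ subset (λ S → u ∈? set S)

  gsoInstance : ℕ → GSOInstance k n
  gsoInstance B = record
    { tree          = T
    ; V             = V
    ; root∈V        = here
    ; parent-closed = RootedTree.within-parent T {B}
    ; group         = λ u → X u ∩ V
    ; group⊆V       = λ u → p∩q⊆q (X u) V
    ; groupWeight   = w
    ; budget        = 2 * m * B
    }
    where
    V = RootedTree.within T B

  -- The budgets are the powers of 2 from 1 to the first one that is at
  -- least m * totalCost.
  Budget : Set
  Budget = Fin (suc ⌈log₂ (m * totalCost) ⌉)

  collection : Budget → Subset k
  collection i = tail (GSOInstance.visited G (gso G))
    where
    G = gsoInstance (2 ^ toℕ i)

  -- One execution: a List-Schedule for every budget with a non-empty
  -- collection.
  record Run : Set where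
    field
      𝓕             : ∀ i → Nonempty (collection i) → Assignment
      listScheduled : ∀ i ne → IsListSchedule (collection i) (𝓕 i ne)

  Returns : Assignment → Set
  Returns F = Σ[ run ∈ Run ] let open Run run in
      (∃[ i ] ∃[ ne ] F ≡ 𝓕 i ne)
    × (∀ i ne → density (𝓕 i ne) ℚ.≤ density F)

module Submission where

{-
Let L be the length of an optimal F* and B a power of 2 with L ≤ B ≤ 2L (or the largest budget, if L
exceeds it). The scheduled sets of F* are predecessor-closed, cost at most mB in total and lie within
distance B of the root, so an Euler tour of them is feasible for the budget 2mB; hence the tour computed for
B covers at least a quarter of the weight of F*. The sets 𝒞 it visits are again predecessor-closed and cost
at most O(log k)·mB, since each is left upwards. In a List-Schedule of 𝒞 every machine p is busy whenever no
set on the chain of predecessors of the last set S is, so the length is at most d(r,S) plus the load of p;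
for the least loaded machine this is B + O(log k)·B, i.e. O(log k)·L.

List-Schedules exist because one can be simulated with integral starting times.
-}

open import Defs
open import Algebra.Properties.CommutativeMonoid.Sum using ()
open import Data.Bool using (true; false; if_then_else_; _∧_)
open import Data.Fin using (Fin; zero; suc; toℕ)
import Data.Fin as Fin
open import Data.Fin.Properties using (any?; all?)
import Data.Fin.Properties as Fin
open import Data.Fin.Subset
  using (Subset; inside; outside; _∈_; _∉_; _⊆_; _∩_; _∪_; _─_; _-_; ⁅_⁆; ⊤; ⊥; ⋃; ∣_∣; Nonempty)
open import Data.Fin.Subset.Properties
import Data.Integer as ℤ
import Data.Integer.Properties as ℤ
open import Data.List using (List; []; _∷_; allFin; map)
import Data.List.Membership.Propositional as List
open import Data.List.Membership.Propositional.Properties using (∈-allFin; ∈-filter⁺; ∈-filter⁻)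
import Data.List.Relation.Unary.All as All
import Data.List.Relation.Unary.All.Properties as All
import Data.List.Relation.Unary.Any as Any
open import Data.Maybe using (just; nothing; maybe)
import Data.Maybe.Properties as Maybe
open import Data.Nat
  using (ℕ; zero; suc; _+_; _*_; _^_; _≤_; _<_; _≤?_; z≤n; s≤s; ⌊_/2⌋; ⌈_/2⌉; NonZero; >-nonZero)
open import Data.Nat.Induction using (<-wellFounded)
open import Data.Nat.Logarithm using (⌊log₂_⌋; ⌈log₂_⌉; ⌊log₂⌋-mono-≤; ⌈log₂⌉-mono-≤)
open import Data.Nat.Logarithm.Core using (⌊log2⌋; ⌈log2⌉)
import Data.Nat.Properties as ℕ
open import Data.Nat.Tactic.RingSolver using (solve-∀)
open import Data.Product using (∃-syntax; Σ-syntax; _×_; _,_; proj₁; proj₂)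
open import Data.Rational using (ℚ; 0ℚ)
import Data.Rational as ℚ
import Data.Rational.Properties as ℚ
open import Data.Rational.Unnormalised using (mkℚᵘ; *≡*; *≤*)
import Data.Rational.Unnormalised as ℚᵘ
import Data.Rational.Unnormalised.Properties as ℚᵘ
open import Data.Sum using (_⊎_; inj₁; inj₂; [_,_]′)
open import Data.Vec using ([]; _∷_; here; there; lookup; tabulate; tail)
open import Data.Vec.Functional using (updateAt)
open import Data.Vec.Functional.Properties using (updateAt-updates; updateAt-minimal)
open import Data.Vec.Properties using ([]=⇒lookup; lookup⇒[]=; lookup∘tabulate; lookup-zipWith)
open import Function using (_∘_; const)
open import Induction.WellFounded using (Acc; acc)
open import Relation.Binary using (DecTotalOrder)
open import Relation.Binary.Construct.Closure.ReflexiveTransitive using (Star; ε; _◅_)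
open import Relation.Binary.Construct.Closure.Transitive using ([_]; _∷_; _∷ʳ_)
open import Relation.Binary.PropositionalEquality
open import Relation.Nullary using (¬_; Dec; yes; no; contradiction; ¬?)
open import Relation.Nullary.Decidable using (_×-dec_; _→-dec_; decidable-stable)

open import Data.List.Extrema (DecTotalOrder.totalOrder ℚ.≤-decTotalOrder) using (max≤v⁺)
open Algebra.Properties.CommutativeMonoid.Sum ℕ.+-0-commutativeMonoid
  using (sum; sum-syntax; sum-cong-≗; ∑-comm; sum-replicate-zero)

-- Logarithms, naturals as rationals, weights of subsets

-- The tour algorithm is only compared with optimal tours, whereas the Euler tour is merely
-- feasible; `feasible-bound` bridges this gap. Starting times of assignments are rational, so time
-- is measured through two dual facts on finitely many intervals: a family covering all times from a
-- to b has total length at least b - a, which bounds a List-Schedule from above, and a disjoint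
-- family between a and b has total length at most b - a, which bounds the loads of F*. The constant
-- is 8(1 + 4C). Coverage loses a factor 4 and the rounding of L to a power of 2 a factor 2. In the
-- List-Schedule the distance contributes B, and the load of a least loaded machine is at most C
-- ⌈log₂ |V|⌉ 2B, where |V| ≤ k + 1 because of the extra root; since ⌈log₂ (k+1)⌉ ≤ 2 ⌊log₂ k⌋, this
-- gives 4C ⌊log₂ k⌋ B.

-- Both logarithms recurse on halves, and ⌈(n+3)/2⌉ = ⌊(n+2)/2⌋ + 1 keeps the two recursions in
-- step.
⌈log2⌉-suc : ∀ n (a : Acc _<_ (suc (suc n))) (b : Acc _<_ (suc n)) →
             ⌈log2⌉ (suc (suc n)) a ≡ suc (⌊log2⌋ (suc n) b)
⌈log2⌉-suc zero    (acc _) _       = refl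
⌈log2⌉-suc (suc n) (acc r) (acc s) = cong suc (⌈log2⌉-suc ⌊ n /2⌋ (r _) (s _))

⌈log₂[1+n]⌉≡1+⌊log₂n⌋ : ∀ n .{{_ : NonZero n}} → ⌈log₂ (suc n) ⌉ ≡ suc ⌊log₂ n ⌋
⌈log₂[1+n]⌉≡1+⌊log₂n⌋ (suc n) = ⌈log2⌉-suc n (<-wellFounded _) (<-wellFounded _)

n≤2*⌈n/2⌉ : ∀ n → n ≤ 2 * ⌈ n /2⌉
n≤2*⌈n/2⌉ n = begin
  n                      ≡⟨ ℕ.⌊n/2⌋+⌈n/2⌉≡n n ⟨
  ⌊ n /2⌋ + ⌈ n /2⌉      ≤⟨ ℕ.+-monoˡ-≤ _ (ℕ.⌊n/2⌋≤⌈n/2⌉ n) ⟩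
  ⌈ n /2⌉ + ⌈ n /2⌉      ≡⟨ cong (⌈ n /2⌉ +_) (ℕ.+-identityʳ _) ⟨
  2 * ⌈ n /2⌉            ∎
  where open ℕ.≤-Reasoning

n≤2^⌈log2⌉n : ∀ n (a : Acc _<_ n) → n ≤ 2 ^ ⌈log2⌉ n a
n≤2^⌈log2⌉n zero          _        = z≤n
n≤2^⌈log2⌉n (suc zero)    _        = ℕ.≤-refl
n≤2^⌈log2⌉n (suc (suc n)) (acc rs) = ℕ.≤-trans (n≤2*⌈n/2⌉ (suc (suc n)))
  (ℕ.*-monoʳ-≤ 2 (n≤2^⌈log2⌉n (suc ⌈ n /2⌉) _))

n≤2^⌈log₂n⌉ : ∀ n → n ≤ 2 ^ ⌈log₂ n ⌉
n≤2^⌈log₂n⌉ n = n≤2^⌈log2⌉n n (<-wellFounded n)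

toℚᵘ-fromℕ : ∀ n → ℚ.toℚᵘ (fromℕ n) ℚᵘ.≃ mkℚᵘ (ℤ.+ n) 0
toℚᵘ-fromℕ n = ℚ.toℚᵘ-fromℚᵘ (mkℚᵘ (ℤ.+ n) 0)

fromℕ-mono-≤ : ∀ {m n} → m ≤ n → fromℕ m ℚ.≤ fromℕ n
fromℕ-mono-≤ {m} {n} m≤n = ℚ.toℚᵘ-cancel-≤
  (ℚᵘ.≤-respʳ-≃ (ℚᵘ.≃-sym (toℚᵘ-fromℕ n)) (ℚᵘ.≤-respˡ-≃ (ℚᵘ.≃-sym (toℚᵘ-fromℕ m))
    (*≤* (ℤ.*-monoʳ-≤-nonNeg (ℤ.+ 1) (ℤ.+≤+ m≤n)))))

fromℕ-cancel-≤ : ∀ {m n} → fromℕ m ℚ.≤ fromℕ n → m ≤ n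
fromℕ-cancel-≤ {m} {n} m≤n
  with *≤* p ← ℚᵘ.≤-respʳ-≃ (toℚᵘ-fromℕ n) (ℚᵘ.≤-respˡ-≃ (toℚᵘ-fromℕ m) (ℚ.toℚᵘ-mono-≤ m≤n))
  = ℤ.drop‿+≤+ (ℤ.*-cancelʳ-≤-pos (ℤ.+ m) (ℤ.+ n) (ℤ.+ 1) p)

fromℕ-cancel-< : ∀ {m n} → fromℕ m ℚ.< fromℕ n → m < n
fromℕ-cancel-< m<n = ℕ.≰⇒> λ n≤m → ℚ.<⇒≢ (ℚ.<-≤-trans m<n (fromℕ-mono-≤ n≤m)) refl

fromℕ-+ : ∀ m n → fromℕ (m + n) ≡ fromℕ m ℚ.+ fromℕ n
fromℕ-+ m n = ℚ.toℚᵘ-injective (begin-equality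
  ℚ.toℚᵘ (fromℕ (m + n))                       ≃⟨ toℚᵘ-fromℕ (m + n) ⟩
  mkℚᵘ (ℤ.+ (m + n)) 0
    ≃⟨ *≡* (cong (ℤ._* ℤ.+ 1) (cong₂ ℤ._+_ (sym (ℤ.*-identityʳ (ℤ.+ m))) (sym (ℤ.*-identityʳ (ℤ.+ n))))) ⟩
  mkℚᵘ (ℤ.+ m) 0 ℚᵘ.+ mkℚᵘ (ℤ.+ n) 0           ≃⟨ ℚᵘ.+-cong (toℚᵘ-fromℕ m) (toℚᵘ-fromℕ n) ⟨
  ℚ.toℚᵘ (fromℕ m) ℚᵘ.+ ℚ.toℚᵘ (fromℕ n)       ≃⟨ ℚ.toℚᵘ-homo-+ (fromℕ m) (fromℕ n) ⟨
  ℚ.toℚᵘ (fromℕ m ℚ.+ fromℕ n)                 ∎)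
  where open ℚᵘ.≤-Reasoning

fromℕ-* : ∀ m n → fromℕ (m * n) ≡ fromℕ m ℚ.* fromℕ n
fromℕ-* m n = ℚ.toℚᵘ-injective (begin-equality
  ℚ.toℚᵘ (fromℕ (m * n))                       ≃⟨ toℚᵘ-fromℕ (m * n) ⟩
  mkℚᵘ (ℤ.+ (m * n)) 0                         ≃⟨ *≡* (cong (ℤ._* ℤ.+ 1) (ℤ.pos-* m n)) ⟩
  mkℚᵘ (ℤ.+ m) 0 ℚᵘ.* mkℚᵘ (ℤ.+ n) 0           ≃⟨ ℚᵘ.*-cong (toℚᵘ-fromℕ m) (toℚᵘ-fromℕ n) ⟨
  ℚ.toℚᵘ (fromℕ m) ℚᵘ.* ℚ.toℚᵘ (fromℕ n)       ≃⟨ ℚ.toℚᵘ-homo-* (fromℕ m) (fromℕ n) ⟨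
  ℚ.toℚᵘ (fromℕ m ℚ.* fromℕ n)                 ∎)
  where open ℚᵘ.≤-Reasoning

0≤fromℕ : ∀ n → 0ℚ ℚ.≤ fromℕ n
0≤fromℕ n = fromℕ-mono-≤ {0} {n} z≤n

p≤p+fromℕ : ∀ p n → p ℚ.≤ p ℚ.+ fromℕ n
p≤p+fromℕ p n = subst (ℚ._≤ p ℚ.+ fromℕ n) (ℚ.+-identityʳ p) (ℚ.+-monoʳ-≤ p (0≤fromℕ n))

x∈p─q⇒x∉q : ∀ {n} (p q : Subset n) {x} → x ∈ p ─ q → x ∉ q
x∈p─q⇒x∉q (_ ∷ p) (outside ∷ q) here         ()
x∈p─q⇒x∉q (_ ∷ p) (outside ∷ q) (there x∈) (there x∈q) = x∈p─q⇒x∉q p q x∈ x∈q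
x∈p─q⇒x∉q (_ ∷ p) (inside ∷ q)  (there x∈) (there x∈q) = x∈p─q⇒x∉q p q x∈ x∈q

x∈p-y⇒x≢y : ∀ {n} (p : Subset n) {x y} → x ∈ p - y → x ≢ y
x∈p-y⇒x≢y p {x} x∈ refl = x∈p─q⇒x∉q p ⁅ x ⁆ x∈ (x∈⁅x⁆ x)

sum-mono-≤ : ∀ {n} {f g : Fin n → ℕ} → (∀ i → f i ≤ g i) → sum f ≤ sum g
sum-mono-≤ {zero}  f≤g = z≤n
sum-mono-≤ {suc n} f≤g = ℕ.+-mono-≤ (f≤g zero) (sum-mono-≤ (f≤g ∘ suc))

sum-const : ∀ n c → ∑[ i < n ] c ≡ n * c
sum-const zero    c = refl
sum-const (suc n) c = cong (c +_) (sum-const n c)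

sum-indicator : ∀ {n} (j : Fin n) c → ∑[ i < n ] (if lookup ⁅ j ⁆ i then c else 0) ≡ c
sum-indicator {suc n} zero c =
  trans (cong (c +_) (trans (sum-cong-≗ {n} outside-⊥) (sum-replicate-zero n))) (ℕ.+-identityʳ c)
  where
  outside-⊥ : ∀ {n} (i : Fin n) → (if lookup ⊥ i then c else 0) ≡ 0
  outside-⊥ zero    = refl
  outside-⊥ (suc i) = outside-⊥ i
sum-indicator {suc n} (suc j) c = sum-indicator j c

weight-mono : ∀ {n} (f : Fin n → ℕ) {p q : Subset n} → p ⊆ q → weight f p ≤ weight f q
weight-mono f {p} {q} p⊆q = sum-mono-≤ pointwise
  where
  pointwise : ∀ i → (if lookup p i then f i else 0) ≤ (if lookup q i then f i else 0)
  pointwise i with lookup p i in eq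
  ... | false = z≤n
  ... | true rewrite []=⇒lookup (p⊆q (lookup⇒[]= i p eq)) = ℕ.≤-refl

weight-∪ : ∀ {n} (f : Fin n → ℕ) (p q : Subset n) → weight f (p ∪ q) ≤ weight f p + weight f q
weight-∪ f []            []            = z≤n
weight-∪ f (outside ∷ p) (outside ∷ q) = weight-∪ (f ∘ suc) p q
weight-∪ f (inside ∷ p)  (outside ∷ q) rewrite ℕ.+-assoc (f zero) (weight (f ∘ suc) p) (weight (f ∘ suc) q) =
  ℕ.+-monoʳ-≤ (f zero) (weight-∪ (f ∘ suc) p q)
weight-∪ f (outside ∷ p) (inside ∷ q)  = begin
  f zero + weight f′ (p ∪ q)             ≤⟨ ℕ.+-monoʳ-≤ (f zero) (weight-∪ f′ p q) ⟩
  f zero + (weight f′ p + weight f′ q)   ≡⟨ ℕ.+-assoc (f zero) _ _ ⟨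
  f zero + weight f′ p + weight f′ q     ≡⟨ cong (_+ weight f′ q) (ℕ.+-comm (f zero) _) ⟩
  weight f′ p + f zero + weight f′ q     ≡⟨ ℕ.+-assoc (weight f′ p) _ _ ⟩
  weight f′ p + (f zero + weight f′ q)   ∎
  where open ℕ.≤-Reasoning
        f′ = f ∘ suc
weight-∪ f (inside ∷ p)  (inside ∷ q)
  rewrite ℕ.+-assoc (f zero) (weight (f ∘ suc) p) (f zero + weight (f ∘ suc) q) =
  ℕ.+-monoʳ-≤ (f zero) (ℕ.≤-trans (weight-∪ (f ∘ suc) p q)
    (ℕ.+-monoʳ-≤ (weight (f ∘ suc) p) (ℕ.m≤n+m _ (f zero))))

weight-remove : ∀ {n} (f : Fin n → ℕ) {x} {p : Subset n} → x ∈ p → weight f p ≡ f x + weight f (p - x)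
weight-remove f {zero}  {inside ∷ p} here = cong (λ q → f zero + weight (f ∘ suc) q) (sym (p─⊥≡p p))
weight-remove f {suc x} {outside ∷ p} (there x∈p) = weight-remove (f ∘ suc) x∈p
weight-remove f {suc x} {inside ∷ p}  (there x∈p) rewrite weight-remove (f ∘ suc) x∈p
  | sym (ℕ.+-assoc (f zero) (f (suc x)) (weight (f ∘ suc) (p - x)))
  | ℕ.+-comm (f zero) (f (suc x)) = ℕ.+-assoc (f (suc x)) (f zero) _

weight-add : ∀ {n} (f : Fin n → ℕ) {x} {p q : Subset n} → x ∉ p → x ∈ q → p ⊆ q →
             f x + weight f p ≤ weight f q
weight-add f {x} {p} {q} x∉p x∈q p⊆q rewrite weight-remove f x∈q =
  ℕ.+-monoʳ-≤ (f x) (weight-mono f {p} {q - x} λ {y} y∈p → x∈p∧x≢y⇒x∈p-y {p = q} (p⊆q y∈p) λ { refl → x∉p y∈p })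

weight-⁅⁆ : ∀ {n} (f : Fin n → ℕ) x → weight f ⁅ x ⁆ ≡ f x
weight-⁅⁆ f x = trans (sum-cong-≗ pointwise) (sum-indicator x (f x))
  where
  pointwise : ∀ i → (if lookup ⁅ x ⁆ i then f i else 0) ≡ (if lookup ⁅ x ⁆ i then f x else 0)
  pointwise i with lookup ⁅ x ⁆ i in eq
  ... | false = refl
  ... | true  = cong f (x∈⁅y⁆⇒x≡y x (lookup⇒[]= i ⁅ x ⁆ eq))

weight-⊤ : ∀ {n} (f : Fin n → ℕ) → weight f ⊤ ≡ sum f
weight-⊤ {zero}  f = refl
weight-⊤ {suc n} f = cong (f zero +_) (weight-⊤ (f ∘ suc))

weight>0⇒nonempty : ∀ {n} (f : Fin n → ℕ) (p : Subset n) → 0 < weight f p → Nonempty p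
weight>0⇒nonempty f (inside ∷ p)  _ = zero , here
weight>0⇒nonempty f (outside ∷ p) pos with weight>0⇒nonempty (f ∘ suc) p pos
... | x , x∈p = suc x , there x∈p

-- Covering and packing by intervals

-- Reading membership off the singleton of `f S` makes the sum over all p an indicator sum, which
-- `sum-indicator` evaluates.
fibre : ∀ {k m} → (Fin k → Fin m) → Fin m → Subset k
fibre f p = tabulate λ S → lookup ⁅ f S ⁆ p

∈-fibre⁺ : ∀ {k m} (f : Fin k → Fin m) S → S ∈ fibre f (f S)
∈-fibre⁺ f S = lookup⇒[]= S _ (trans (lookup∘tabulate _ S) ([]=⇒lookup (x∈⁅x⁆ (f S))))

∈-fibre⁻ : ∀ {k m} (f : Fin k → Fin m) {p S} → S ∈ fibre f p → f S ≡ p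
∈-fibre⁻ f {p} {S} S∈ = sym (x∈⁅y⁆⇒x≡y (f S)
  (lookup⇒[]= p _ (trans (sym (lookup∘tabulate _ S)) ([]=⇒lookup S∈))))

∑-weight-fibre : ∀ {k m} (c : Fin k → ℕ) (f : Fin k → Fin m) (X : Subset k) →
                 ∑[ p < m ] weight c (X ∩ fibre f p) ≡ weight c X
∑-weight-fibre {k} {m} c f X = trans (∑-comm {m} {k} _) (sum-cong-≗ pointwise)
  where
  pointwise : ∀ S → ∑[ p < m ] (if lookup (X ∩ fibre f p) S then c S else 0) ≡
                    (if lookup X S then c S else 0)
  pointwise S = trans (sum-cong-≗ unfold) (collapse (lookup X S))
    where
    unfold : ∀ p → (if lookup (X ∩ fibre f p) S then c S else 0) ≡
                   (if lookup X S ∧ lookup ⁅ f S ⁆ p then c S else 0)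
    unfold p = cong (if_then c S else 0) (trans (lookup-zipWith _∧_ S X _)
      (cong (lookup X S ∧_) (lookup∘tabulate _ S)))

    collapse : ∀ b → ∑[ p < m ] (if b ∧ lookup ⁅ f S ⁆ p then c S else 0) ≡ (if b then c S else 0)
    collapse true  = sum-indicator (f S) (c S)
    collapse false = sum-replicate-zero m

average : ∀ {m} → 0 < m → (f : Fin m → ℕ) {D : ℕ} → sum f ≤ m * D → ∃[ p ] f p ≤ D
average {m} m>0 f {D} ∑f≤mD with any? (λ p → f p ≤? D)
... | yes p = p
... | no ¬p = contradiction mD<mD (ℕ.<-irrefl refl)
  where
  open ℕ.≤-Reasoning
  mD<mD : m * D < m * D
  mD<mD = begin-strict
    m * D               <⟨ ℕ.*-monoʳ-< m {{>-nonZero m>0}} (ℕ.n<1+n D) ⟩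
    m * suc D           ≡⟨ sum-const m (suc D) ⟨
    ∑[ p < m ] suc D    ≤⟨ sum-mono-≤ (λ p → ℕ.≰⇒> λ fp≤D → ¬p (p , fp≤D)) ⟩
    sum f               ≤⟨ ∑f≤mD ⟩
    m * D               ∎

module Intervals {n} (start : Fin n → ℚ) (c : Fin n → ℕ) where

  finish : Fin n → ℚ
  finish i = start i ℚ.+ fromℕ (c i)

  _∋_ : Fin n → ℚ → Set
  i ∋ t = start i ℚ.≤ t × t ℚ.< finish i

  -- The interval i that contains a contains no time from `finish i` on, so the remaining intervals
  -- cover everything from `finish i` to b. The induction removes i; d bounds the number of
  -- intervals left.
  cover-length : ∀ X {a b} → (∀ {t} → a ℚ.≤ t → t ℚ.< b → ∃[ i ] i ∈ X × i ∋ t) →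
                 b ℚ.≤ a ℚ.+ fromℕ (weight c X)
  cover-length X = go ∣ X ∣ X ℕ.≤-refl
    where
    go : ∀ d X → ∣ X ∣ ≤ d → ∀ {a b} → (∀ {t} → a ℚ.≤ t → t ℚ.< b → ∃[ i ] i ∈ X × i ∋ t) →
         b ℚ.≤ a ℚ.+ fromℕ (weight c X)
    go d X ∣X∣≤d {a} {b} cov with b ℚ.≤? a
    ... | yes b≤a = ℚ.≤-trans b≤a (p≤p+fromℕ a (weight c X))
    ... | no b≰a with cov ℚ.≤-refl (ℚ.≰⇒> b≰a)
    ... | i , i∈X , si≤a , a<fi with d
    ... | zero  = contradiction (ℕ.<-≤-trans (x∈p⇒∣p-x∣<∣p∣ i∈X) ∣X∣≤d) λ ()
    ... | suc d = begin
      b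
        ≤⟨ go d (X - i) (ℕ.≤-pred (ℕ.<-≤-trans (x∈p⇒∣p-x∣<∣p∣ i∈X) ∣X∣≤d)) cov′ ⟩
      start i ℚ.+ fromℕ (c i) ℚ.+ fromℕ (weight c (X - i)) ≤⟨ ℚ.+-monoˡ-≤ _ (ℚ.+-monoˡ-≤ _ si≤a) ⟩
      a ℚ.+ fromℕ (c i) ℚ.+ fromℕ (weight c (X - i))       ≡⟨ ℚ.+-assoc a _ _ ⟩
      a ℚ.+ (fromℕ (c i) ℚ.+ fromℕ (weight c (X - i)))     ≡⟨ cong (a ℚ.+_) (fromℕ-+ (c i) _) ⟨
      a ℚ.+ fromℕ (c i + weight c (X - i))
        ≡⟨ cong (λ w → a ℚ.+ fromℕ w) (weight-remove c i∈X) ⟨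
      a ℚ.+ fromℕ (weight c X)                             ∎
      where
      open ℚ.≤-Reasoning hiding (start)
      cov′ : ∀ {t} → finish i ℚ.≤ t → t ℚ.< b → ∃[ j ] j ∈ X - i × j ∋ t
      cov′ fi≤t t<b with cov (ℚ.≤-trans (ℚ.<⇒≤ a<fi) fi≤t) t<b
      ... | j , j∈X , sj≤t , t<fj =
        j , x∈p∧x≢y⇒x∈p-y j∈X (λ { refl → ℚ.<⇒≢ (ℚ.<-≤-trans t<fj fi≤t) refl }) , sj≤t , t<fj

  record Packed (a b : ℚ) (X : Subset n) : Set where
    field
      a≤b      : a ℚ.≤ b
      a≤start  : ∀ {i} → i ∈ X → a ℚ.≤ start i
      finish≤b : ∀ {i} → i ∈ X → finish i ℚ.≤ b
      disjoint : ∀ {i j} → i ∈ X → j ∈ X → i ≢ j → finish i ℚ.≤ start j ⊎ finish j ℚ.≤ start i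

  -- Quicksort recursion: split the remaining intervals into those before and those after i.
  packed-length : ∀ {a b} X → Packed a b X → a ℚ.+ fromℕ (weight c X) ℚ.≤ b
  packed-length X = go ∣ X ∣ X ℕ.≤-refl
    where
    go : ∀ d X → ∣ X ∣ ≤ d → ∀ {a b} → Packed a b X → a ℚ.+ fromℕ (weight c X) ℚ.≤ b
    go d X ∣X∣≤d {a} {b} packed with nonempty? X
    ... | no empty
      rewrite ℕ.n≤0⇒n≡0 (ℕ.≮⇒≥ (empty ∘ weight>0⇒nonempty c X)) | ℚ.+-identityʳ a = Packed.a≤b packed
    ... | yes (i , i∈X) with d
    ... | zero  = contradiction (ℕ.<-≤-trans (x∈p⇒∣p-x∣<∣p∣ i∈X) ∣X∣≤d) λ ()
    ... | suc d = begin
      a ℚ.+ fromℕ (weight c X)                                   ≤⟨ ℚ.+-monoʳ-≤ a (fromℕ-mono-≤ split) ⟩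
      a ℚ.+ fromℕ (wl + (c i + wr))
        ≡⟨ cong (a ℚ.+_) (trans (fromℕ-+ wl _) (cong (fromℕ wl ℚ.+_) (fromℕ-+ (c i) wr))) ⟩
      a ℚ.+ (fromℕ wl ℚ.+ (fromℕ (c i) ℚ.+ fromℕ wr))            ≡⟨ ℚ.+-assoc a _ _ ⟨
      a ℚ.+ fromℕ wl ℚ.+ (fromℕ (c i) ℚ.+ fromℕ wr)              ≤⟨ ℚ.+-monoˡ-≤ _ left-length ⟩
      start i ℚ.+ (fromℕ (c i) ℚ.+ fromℕ wr)                     ≡⟨ ℚ.+-assoc (start i) _ _ ⟨
      finish i ℚ.+ fromℕ wr                                      ≤⟨ right-length ⟩
      b                                                          ∎
      where
      open ℚ.≤-Reasoning hiding (start)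
      open Packed packed
      rest left right : Subset n
      left?  = λ j → (j ∈? X - i) ×-dec (finish j ℚ.≤? start i)
      right? = λ j → (j ∈? X - i) ×-dec (finish i ℚ.≤? start j)
      rest  = X - i
      left  = subset left?
      right = subset right?
      wl wr : ℕ
      wl = weight c left
      wr = weight c right

      rest⊆ : rest ⊆ left ∪ right
      rest⊆ {j} j∈ with disjoint (p─q⊆p X ⁅ i ⁆ j∈) i∈X (x∈p-y⇒x≢y X j∈)
      ... | inj₁ fj≤si = x∈p∪q⁺ (inj₁ (∈-subset⁺ left? (j∈ , fj≤si)))
      ... | inj₂ fi≤sj = x∈p∪q⁺ (inj₂ (∈-subset⁺ right? (j∈ , fi≤sj)))

      split : weight c X ≤ wl + (c i + wr)
      split = ℕ.≤-trans (ℕ.≤-reflexive (weight-remove c i∈X))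
        (ℕ.≤-trans (ℕ.+-monoʳ-≤ (c i) (ℕ.≤-trans (weight-mono c {rest} rest⊆) (weight-∪ c left right)))
          (ℕ.≤-reflexive (trans (sym (ℕ.+-assoc (c i) wl wr))
            (trans (cong (_+ wr) (ℕ.+-comm (c i) wl)) (ℕ.+-assoc wl (c i) wr)))))

      smaller : ∀ {Y} → Y ⊆ rest → ∣ Y ∣ ≤ d
      smaller Y⊆ = ℕ.≤-pred (ℕ.<-≤-trans (ℕ.≤-<-trans (p⊆q⇒∣p∣≤∣q∣ Y⊆) (x∈p⇒∣p-x∣<∣p∣ i∈X)) ∣X∣≤d)

      left⊆ : left ⊆ rest
      left⊆ j∈ = proj₁ (∈-subset⁻ left? j∈)
      right⊆ : right ⊆ rest
      right⊆ j∈ = proj₁ (∈-subset⁻ right? j∈)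
      ⊆X : ∀ {j} → j ∈ rest → j ∈ X
      ⊆X = p─q⊆p X ⁅ i ⁆

      left-length : a ℚ.+ fromℕ wl ℚ.≤ start i
      left-length = go d left (smaller left⊆) record
        { a≤b      = a≤start i∈X
        ; a≤start  = λ j∈ → a≤start (⊆X (left⊆ j∈))
        ; finish≤b = λ j∈ → proj₂ (∈-subset⁻ left? j∈)
        ; disjoint = λ j∈ l∈ → disjoint (⊆X (left⊆ j∈)) (⊆X (left⊆ l∈))
        }

      right-length : finish i ℚ.+ fromℕ wr ℚ.≤ b
      right-length = go d right (smaller right⊆) record
        { a≤b      = finish≤b i∈X
        ; a≤start  = λ j∈ → proj₂ (∈-subset⁻ right? j∈)
        ; finish≤b = λ j∈ → finish≤b (⊆X (right⊆ j∈))
        ; disjoint = λ j∈ l∈ → disjoint (⊆X (right⊆ j∈)) (⊆X (right⊆ l∈))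
        }

-- Tours on trees

∈-tail⁺ : ∀ {n} {p : Subset (suc n)} {x} → suc x ∈ p → x ∈ tail p
∈-tail⁺ (there x∈) = x∈

∈-tail⁻ : ∀ {n} {p : Subset (suc n)} {x} → x ∈ tail p → suc x ∈ p
∈-tail⁻ {p = _ ∷ _} x∈ = there x∈

module _ {k} (T : RootedTree k) where
  open RootedTree T

  distAcc-root : ∀ S → directPred S ≡ nothing → ∀ a → distAcc S a ≡ edgeLength S
  distAcc-root S eq (acc _) with directPred S
  distAcc-root S refl (acc _) | nothing = refl

  distAcc-child : ∀ {P} S → P ≺₁ S → ∀ a b → distAcc S a ≡ edgeLength S + distAcc P b
  distAcc-child S eq (acc _) b with directPred S
  distAcc-child S refl (acc rs) b | just P = cong (edgeLength S +_) (distAcc-irrelevant P (rs refl) b)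

  rootDist-root : ∀ {S} → directPred S ≡ nothing → rootDist S ≡ edgeLength S
  rootDist-root {S} eq = distAcc-root S eq (≺₁-wellFounded S)

  rootDist-child : ∀ {P S} → P ≺₁ S → rootDist S ≡ edgeLength S + rootDist P
  rootDist-child {P} {S} P≺S = distAcc-child S P≺S (≺₁-wellFounded S) (≺₁-wellFounded P)

  -- Each step towards the root takes one edge out of X, and acyclicity keeps the remaining
  -- predecessors in `X - S`, so no edge is counted twice. Applied to all sets, it shows that the
  -- largest budget removes no vertex from the tree.
  rootDist≤weight : ∀ {S} X → S ∈ X → (∀ {P} → P ≺ S → P ∈ X) → rootDist S ≤ weight edgeLength X
  rootDist≤weight {S} = go S (≺₁-wellFounded S)
    where
    go : ∀ S → Acc _≺₁_ S → ∀ X → S ∈ X → (∀ {P} → P ≺ S → P ∈ X) → rootDist S ≤ weight edgeLength X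
    go S (acc rs) X S∈X ≺S⊆X rewrite weight-remove edgeLength S∈X with directPred S in eq
    ... | nothing rewrite rootDist-root eq = ℕ.m≤m+n _ _
    ... | just P  rewrite rootDist-child eq = ℕ.+-monoʳ-≤ (edgeLength S)
      (go P (rs refl) (X - S) (member [ eq ]) (λ Q≺P → member (Q≺P ∷ʳ eq)))
      where
      member : ∀ {Q} → Q ≺ S → Q ∈ X - S
      member Q≺S = x∈p∧x≢y⇒x∈p-y (≺S⊆X Q≺S) λ { refl → acyclic S Q≺S }

module Tours {k g} (G : GSOInstance k g) where
  open GSOInstance G

  start∈visited : ∀ {u v} (τ : Star Edge u v) → u ∈ visited τ
  start∈visited {u} ε       = x∈⁅x⁆ u
  start∈visited {u} (_ ◅ τ) = p⊆p∪q (visited τ) (x∈⁅x⁆ u)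

  visited⊆V : ∀ {v} (τ : Star Edge v zero) → visited τ ⊆ V
  visited⊆V ε x∈ rewrite x∈⁅y⁆⇒x≡y zero x∈ = root∈V
  visited⊆V {v} (e ◅ τ) x∈ with x∈p∪q⁻ ⁅ v ⁆ (visited τ) x∈
  ... | inj₂ x∈τ = visited⊆V τ x∈τ
  ... | inj₁ x∈v rewrite x∈⁅y⁆⇒x≡y v x∈v with e
  ...   | up S∈V _        = S∈V
  ...   | down {S} S∈V refl = parent-closed S S∈V

  -- The walk ends at the root, so whatever it enters downwards it must leave upwards again. This
  -- makes the visited sets predecessor-closed, and it shows that a downward step adds no vertex
  -- that the rest of the walk misses.
  visited-parent : ∀ {v} (τ : Star Edge v zero) {S} → suc S ∈ visited τ → parent S ∈ visited τ
  visited-parent ε S∈ = contradiction (x∈⁅y⁆⇒x≡y zero S∈) λ ()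
  visited-parent (up {S′} _ refl ◅ τ) S∈ with x∈p∪q⁻ ⁅ suc S′ ⁆ (visited τ) S∈
  ... | inj₂ S∈τ = q⊆p∪q ⁅ suc S′ ⁆ (visited τ) (visited-parent τ S∈τ)
  ... | inj₁ S∈S′ with refl ← x∈⁅y⁆⇒x≡y (suc S′) S∈S′ = q⊆p∪q ⁅ suc S′ ⁆ (visited τ) (start∈visited τ)
  visited-parent {v} (down _ refl ◅ τ) S∈ with x∈p∪q⁻ ⁅ v ⁆ (visited τ) S∈
  ... | inj₂ S∈τ = q⊆p∪q ⁅ v ⁆ (visited τ) (visited-parent τ S∈τ)
  -- The rest τ starts at a child of v: one use of the induction hypothesis shows that τ comes back
  -- to v, a second one that it reaches the parent of v.
  ... | inj₁ S∈v = q⊆p∪q ⁅ v ⁆ (visited τ) (visited-parent τ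
      (subst (_∈ visited τ) (sym (x∈⁅y⁆⇒x≡y v S∈v)) (visited-parent τ (start∈visited τ))))

  -- Every visited vertex other than the root is left upwards on the way back, so its edge is paid for.
  weight-visited≤walkLength : ∀ {v} (τ : Star Edge v zero) → weight edgeLength (tail (visited τ)) ≤ walkLength τ
  weight-visited≤walkLength ε = ℕ.≮⇒≥ λ pos → let S , S∈ = weight>0⇒nonempty edgeLength _ pos in
    contradiction (x∈⁅y⁆⇒x≡y zero (∈-tail⁻ {p = ⁅ zero ⁆} S∈)) λ ()
  weight-visited≤walkLength (up {S} S∈V refl ◅ τ) = begin
    weight edgeLength (tail (⁅ suc S ⁆ ∪ visited τ))
      ≤⟨ weight-mono edgeLength {tail (⁅ suc S ⁆ ∪ visited τ)} {⁅ S ⁆ ∪ tail (visited τ)} sub ⟩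
    weight edgeLength (⁅ S ⁆ ∪ tail (visited τ))
      ≤⟨ weight-∪ edgeLength ⁅ S ⁆ (tail (visited τ)) ⟩
    weight edgeLength ⁅ S ⁆ + weight edgeLength (tail (visited τ))
      ≡⟨ cong (_+ weight edgeLength (tail (visited τ))) (weight-⁅⁆ edgeLength S) ⟩
    edgeLength S + weight edgeLength (tail (visited τ))
      ≤⟨ ℕ.+-monoʳ-≤ (edgeLength S) (weight-visited≤walkLength τ) ⟩
    edgeLength S + walkLength τ                                        ∎
    where
    open ℕ.≤-Reasoning
    sub : tail (⁅ suc S ⁆ ∪ visited τ) ⊆ ⁅ S ⁆ ∪ tail (visited τ)
    sub x∈ with x∈p∪q⁻ ⁅ suc S ⁆ (visited τ) (∈-tail⁻ {p = ⁅ suc S ⁆ ∪ visited τ} x∈)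
    ... | inj₁ (there x∈S) = x∈p∪q⁺ (inj₁ x∈S)
    ... | inj₂ x∈τ         = x∈p∪q⁺ (inj₂ (∈-tail⁺ x∈τ))
  weight-visited≤walkLength {v} (e@(down {S} S∈V refl) ◅ τ) = begin
    weight edgeLength (tail (⁅ v ⁆ ∪ visited τ))
      ≤⟨ weight-mono edgeLength {tail (⁅ v ⁆ ∪ visited τ)} {tail (visited τ)} sub ⟩
    weight edgeLength (tail (visited τ))          ≤⟨ weight-visited≤walkLength τ ⟩
    walkLength τ                                  ≤⟨ ℕ.m≤n+m _ (edgeLength S) ⟩
    edgeLength S + walkLength τ                   ∎
    where
    open ℕ.≤-Reasoning
    sub : tail (⁅ v ⁆ ∪ visited τ) ⊆ tail (visited τ)
    sub x∈ with x∈p∪q⁻ ⁅ v ⁆ (visited τ) (∈-tail⁻ {p = ⁅ v ⁆ ∪ visited τ} x∈)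
    ... | inj₁ x∈v = ∈-tail⁺ (subst (_∈ visited τ) (sym (x∈⁅y⁆⇒x≡y v x∈v)) (visited-parent τ (start∈visited τ)))
    ... | inj₂ x∈τ = ∈-tail⁺ x∈τ

  -- The result of splicing the excursion parent, S, parent into a walk. `only` keeps the enlarged
  -- tour inside the family, and `length≡` charges the edge of S twice.
  record Detour {u v} (τ : Star Edge u v) (S : Fin k) : Set where
    field
      walk      : Star Edge u v
      length≡   : walkLength walk ≡ 2 * edgeLength S + walkLength τ
      new       : suc S ∈ visited walk
      old       : visited τ ⊆ visited walk
      only      : ∀ {x} → x ∈ visited walk → x ≡ suc S ⊎ x ∈ visited τ

  detour-at-start : ∀ {u v} (τ : Star Edge u v) {S} → suc S ∈ V → parent S ≡ u → Detour τ S
  detour-at-start {u} τ {S} S∈V refl = record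
    { walk    = down S∈V refl ◅ up S∈V refl ◅ τ
    ; length≡ = trans (sym (ℕ.+-assoc (edgeLength S) _ _))
                  (cong (λ x → edgeLength S + x + walkLength τ) (sym (ℕ.+-identityʳ (edgeLength S))))
    ; new     = q⊆p∪q ⁅ u ⁆ _ (p⊆p∪q (visited τ) (x∈⁅x⁆ (suc S)))
    ; old     = λ x∈ → q⊆p∪q ⁅ u ⁆ _ (q⊆p∪q ⁅ suc S ⁆ _ x∈)
    ; only    = only
    }
    where
    only : ∀ {x} → x ∈ ⁅ u ⁆ ∪ (⁅ suc S ⁆ ∪ visited τ) → x ≡ suc S ⊎ x ∈ visited τ
    only x∈ with x∈p∪q⁻ ⁅ u ⁆ _ x∈
    ... | inj₁ x∈u = inj₂ (subst (_∈ visited τ) (sym (x∈⁅y⁆⇒x≡y u x∈u)) (start∈visited τ))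
    ... | inj₂ x∈′ with x∈p∪q⁻ ⁅ suc S ⁆ _ x∈′
    ...   | inj₁ x∈S = inj₁ (x∈⁅y⁆⇒x≡y (suc S) x∈S)
    ...   | inj₂ x∈τ = inj₂ x∈τ

  detour : ∀ {u v} (τ : Star Edge u v) {S} → suc S ∈ V → parent S ∈ visited τ → Detour τ S
  detour {u} ε S∈V P∈ = detour-at-start ε S∈V (x∈⁅y⁆⇒x≡y u P∈)
  detour {u} (e ◅ τ) {S} S∈V P∈ with x∈p∪q⁻ ⁅ u ⁆ (visited τ) P∈
  ... | inj₁ P∈u = detour-at-start (e ◅ τ) S∈V (x∈⁅y⁆⇒x≡y u P∈u)
  ... | inj₂ P∈τ = record
    { walk    = e ◅ walk
    ; length≡ = trans (cong (stepLength e +_) length≡) (trans (sym (ℕ.+-assoc (stepLength e) _ _))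
                  (trans (cong (_+ walkLength τ) (ℕ.+-comm (stepLength e) _))
                    (ℕ.+-assoc (2 * edgeLength S) _ _)))
    ; new     = q⊆p∪q ⁅ u ⁆ _ new
    ; old     = old′
    ; only    = only′
    }
    where
    open Detour (detour τ S∈V P∈τ)
    old′ : visited (e ◅ τ) ⊆ visited (e ◅ walk)
    old′ x∈ with x∈p∪q⁻ ⁅ u ⁆ (visited τ) x∈
    ... | inj₁ x∈u = p⊆p∪q (visited walk) x∈u
    ... | inj₂ x∈τ = q⊆p∪q ⁅ u ⁆ (visited walk) (old x∈τ)
    only′ : ∀ {x} → x ∈ visited (e ◅ walk) → x ≡ suc S ⊎ x ∈ visited (e ◅ τ)
    only′ x∈ with x∈p∪q⁻ ⁅ u ⁆ (visited walk) x∈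
    ... | inj₁ x∈u = inj₂ (p⊆p∪q (visited τ) x∈u)
    ... | inj₂ x∈w with only x∈w
    ...   | inj₁ x≡S = inj₁ x≡S
    ...   | inj₂ x∈τ = inj₂ (q⊆p∪q ⁅ u ⁆ (visited τ) x∈τ)

  module _ (𝒮 : Subset k) (closed : ∀ {P S} → S ∈ 𝒮 → P ≺₁ S → P ∈ 𝒮)
           (𝒮⊆V : ∀ {S} → S ∈ 𝒮 → suc S ∈ V) where

    -- The length is bounded through the sets visited so far, which makes the bound an invariant of
    -- detours to new sets; `within𝒮` turns it into a bound by the whole family.
    record PartialEulerTour : Set where
      field
        tour    : Tour
        length≤ : walkLength tour ≤ 2 * weight edgeLength (tail (visited tour))
        within𝒮 : tail (visited tour) ⊆ 𝒮

    open PartialEulerTour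

    -- A detour to S can only leave from its parent, so the predecessors are visited first; the
    -- recursion stops at vertex `zero`, where every tour starts.
    extend : ∀ {S} → S ∈ 𝒮 → (τ : PartialEulerTour) →
             Σ[ τ′ ∈ PartialEulerTour ] visited (tour τ) ⊆ visited (tour τ′) × suc S ∈ visited (tour τ′)
    extend {S} = go S (≺₁-wellFounded S)
      where
      withParent : ∀ {S} → S ∈ 𝒮 → (τ : PartialEulerTour) → parent S ∈ visited (tour τ) →
                   Σ[ τ′ ∈ PartialEulerTour ] visited (tour τ) ⊆ visited (tour τ′) × suc S ∈ visited (tour τ′)
      withParent {S} S∈ τ P∈ with suc S ∈? visited (tour τ)
      ... | yes S∈τ = τ , (λ x∈ → x∈) , S∈τ
      ... | no S∉τ  = τ′ , old , new
        where
        open Detour (detour (tour τ) (𝒮⊆V S∈) P∈)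
        open ℕ.≤-Reasoning
        τ′ : PartialEulerTour
        τ′ = record
          { tour    = walk
          ; length≤ = begin
              walkLength walk                                                          ≡⟨ length≡ ⟩
              2 * edgeLength S + walkLength (tour τ)
                ≤⟨ ℕ.+-monoʳ-≤ (2 * edgeLength S) (length≤ τ) ⟩
              2 * edgeLength S + 2 * weight edgeLength (tail (visited (tour τ)))
                ≡⟨ ℕ.*-distribˡ-+ 2 (edgeLength S) _ ⟨
              2 * (edgeLength S + weight edgeLength (tail (visited (tour τ))))
                -- S was unvisited, so its edge is not yet in the sum and pays for the two new
                -- traversals.
                ≤⟨ ℕ.*-monoʳ-≤ 2 (weight-add edgeLength {S} {tail (visited (tour τ))} {tail (visited walk)}
                   (λ S∈ → S∉τ (∈-tail⁻ S∈)) (∈-tail⁺ new) (λ x∈ → ∈-tail⁺ (old (∈-tail⁻ x∈)))) ⟩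
              2 * weight edgeLength (tail (visited walk))                              ∎
          ; within𝒮 = λ x∈ → within′ (only (∈-tail⁻ x∈))
          }
          where
          within′ : ∀ {Q} → suc Q ≡ suc S ⊎ suc Q ∈ visited (tour τ) → Q ∈ 𝒮
          within′ (inj₁ refl) = S∈
          within′ (inj₂ Q∈τ)  = within𝒮 τ (∈-tail⁺ Q∈τ)

      go : ∀ S → Acc _≺₁_ S → S ∈ 𝒮 → (τ : PartialEulerTour) →
           Σ[ τ′ ∈ PartialEulerTour ] visited (tour τ) ⊆ visited (tour τ′) × suc S ∈ visited (tour τ′)
      go S (acc rs) S∈ τ with directPred S in eq
      ... | nothing = withParent S∈ τ
        (subst (_∈ visited (tour τ)) (sym (cong (maybe suc zero) eq)) (start∈visited (tour τ)))
      ... | just P with go P (rs refl) (closed S∈ eq) τ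
      ...   | τ₁ , τ⊆τ₁ , P∈τ₁
        with withParent S∈ τ₁ (subst (_∈ visited (tour τ₁)) (sym (cong (maybe suc zero) eq)) P∈τ₁)
      ...     | τ₂ , τ₁⊆τ₂ , S∈τ₂ = τ₂ , (λ x∈ → τ₁⊆τ₂ (τ⊆τ₁ x∈)) , S∈τ₂

    visitAll : (xs : List (Fin k)) →
               Σ[ τ ∈ PartialEulerTour ] (∀ {S} → S List.∈ xs → S ∈ 𝒮 → suc S ∈ visited (tour τ))
    visitAll [] = record
      { tour    = ε
      ; length≤ = z≤n
      ; within𝒮 = λ x∈ → contradiction (x∈⁅y⁆⇒x≡y zero (∈-tail⁻ {p = ⁅ zero ⁆} x∈)) λ ()
      } , λ ()
    visitAll (x ∷ xs) with visitAll xs | x ∈? 𝒮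
    ... | τ , all | no x∉  = τ , λ { (Any.here refl) S∈ → contradiction S∈ x∉ ; (Any.there S∈xs) → all S∈xs }
    ... | τ , all | yes x∈ with extend x∈ τ
    ...   | τ′ , τ⊆τ′ , x∈τ′ = τ′ , λ { (Any.here refl) _ → x∈τ′ ; (Any.there S∈xs) S∈ → τ⊆τ′ (all S∈xs S∈) }

    euler-tour : Σ[ τ ∈ Tour ] walkLength τ ≤ 2 * weight edgeLength 𝒮 × (∀ {S} → S ∈ 𝒮 → suc S ∈ visited τ)
    euler-tour with visitAll (allFin k)
    ... | τ , all = tour τ
      , ℕ.≤-trans (length≤ τ) (ℕ.*-monoʳ-≤ 2 (weight-mono edgeLength {tail (visited (tour τ))} {𝒮} (within𝒮 τ)))
      , λ {S} → all (∈-allFin S)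

  -- Coverage is bounded, so repeatedly passing to a better tour would reach an optimal one;
  -- ≤ on ℕ being stable, this suffices without constructing an optimal tour.
  feasible-bound : ∀ {N} → (∀ τ* → IsOptimalTour τ* → coveredWeight τ* ≤ N) →
                   ∀ τ → walkLength τ ≤ budget → coveredWeight τ ≤ N
  feasible-bound {N} optimal≤N τ feasible = ℕ.≮⇒≥ (go (weight groupWeight ⊤) τ (ℕ.m≤m+n _ _) feasible)
    where
    -- d bounds the weight still uncovered, so every improvement uses up at least one unit of it.
    go : ∀ d τ → weight groupWeight ⊤ ≤ d + coveredWeight τ → walkLength τ ≤ budget → ¬ (N < coveredWeight τ)
    go d τ bound feasible N< = ℕ.<⇒≱ N<
      (optimal≤N τ (feasible , λ τ′ feasible′ → ℕ.≮⇒≥ λ better → improve d bound τ′ feasible′ better))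
      where
      improve : ∀ d → weight groupWeight ⊤ ≤ d + coveredWeight τ →
                ∀ τ′ → walkLength τ′ ≤ budget → ¬ (coveredWeight τ < coveredWeight τ′)
      improve zero    bound τ′ _ better =
        ℕ.<⇒≱ better (ℕ.≤-trans (weight-mono groupWeight {coveredGroups τ′} {⊤} (λ _ → ∈⊤)) bound)
      improve (suc d) bound τ′ feasible′ better = go d τ′
        (ℕ.≤-trans bound (ℕ.≤-trans (ℕ.≤-reflexive (sym (ℕ.+-suc d _))) (ℕ.+-monoʳ-≤ d better)))
        feasible′ (ℕ.<-trans N< better)

-- List scheduling

module _ {k} (T : RootedTree k) (start finish : Fin k → ℚ) (𝒞 : Subset k) (Busy : ℚ → Set) where
  open RootedTree T

  -- Q is the chain from S up to its root, whose lengths add up to `rootDist S`. At a time before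
  -- `finish S` there are three cases: S is running; S has not started although its direct
  -- predecessor is completed or absent, and `waiting` applies; or that predecessor is unfinished,
  -- and induction applies to it.
  chain-covers : (∀ {P S} → S ∈ 𝒞 → P ≺₁ S → P ∈ 𝒞) →
    (∀ {S t} → S ∈ 𝒞 → 0ℚ ℚ.≤ t → t ℚ.< start S → (∀ {P} → P ≺₁ S → P ∈ 𝒞 × finish P ℚ.≤ t) → Busy t) →
    ∀ {S} → S ∈ 𝒞 → ∃[ Q ] weight edgeLength Q ≤ rootDist S ×
    (∀ {t} → 0ℚ ℚ.≤ t → t ℚ.< finish S → (∃[ J ] J ∈ Q × start J ℚ.≤ t × t ℚ.< finish J) ⊎ Busy t)
  chain-covers closed waiting {S} = go S (≺₁-wellFounded S)
    where
    Covers : Subset k → Fin k → Set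
    Covers Q S = ∀ {t} → 0ℚ ℚ.≤ t → t ℚ.< finish S → (∃[ J ] J ∈ Q × start J ℚ.≤ t × t ℚ.< finish J) ⊎ Busy t

    go : ∀ S → Acc _≺₁_ S → S ∈ 𝒞 → ∃[ Q ] weight edgeLength Q ≤ rootDist S × Covers Q S
    go S (acc rs) S∈ with directPred S in eq
    ... | nothing = ⁅ S ⁆ , ℕ.≤-reflexive (trans (weight-⁅⁆ edgeLength S) (sym (rootDist-root T eq))) , covers
      where
      covers : Covers ⁅ S ⁆ S
      covers {t} 0≤t t<f with start S ℚ.≤? t
      ... | yes s≤t = inj₁ (S , x∈⁅x⁆ S , s≤t , t<f)
      ... | no s≰t  = inj₂ (waiting S∈ 0≤t (ℚ.≰⇒> s≰t) λ P≺S → contradiction (trans (sym P≺S) eq) λ ())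
    ... | just P with go P (rs refl) (closed S∈ eq)
    ...   | Q , wQ , coversP = ⁅ S ⁆ ∪ Q , bound , covers
      where
      bound : weight edgeLength (⁅ S ⁆ ∪ Q) ≤ rootDist S
      bound = ℕ.≤-trans (weight-∪ edgeLength ⁅ S ⁆ Q)
        (ℕ.≤-trans (ℕ.+-mono-≤ (ℕ.≤-reflexive (weight-⁅⁆ edgeLength S)) wQ)
          (ℕ.≤-reflexive (sym (rootDist-child T eq))))

      covers : Covers (⁅ S ⁆ ∪ Q) S
      covers {t} 0≤t t<f with start S ℚ.≤? t
      ... | yes s≤t = inj₁ (S , x∈p∪q⁺ (inj₁ (x∈⁅x⁆ S)) , s≤t , t<f)
      ... | no s≰t with t ℚ.<? finish P
      ...   | yes t<fP = [ (λ (J , J∈Q , J∋t) → inj₁ (J , q⊆p∪q ⁅ S ⁆ Q J∈Q , J∋t)) , inj₂ ]′ (coversP 0≤t t<fP)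
      ...   | no t≮fP  = inj₂ (waiting S∈ 0≤t (ℚ.≰⇒> s≰t) λ R≺S →
        subst (λ R → R ∈ 𝒞 × finish R ℚ.≤ t) (Maybe.just-injective (trans (sym eq) R≺S))
          (closed S∈ eq , ℚ.≮⇒≥ t≮fP))

module Scheduling {k} (I : PCPDS k) where
  open PCPDS I
  open OutForest precedence using (_≺₁_; directPred; ≺₁-wellFounded)

  tree : RootedTree k
  tree = record { forest = precedence ; edgeLength = cost ; edgeLength>0 = cost>0 }

  open RootedTree tree using (rootDist)

  module _ (F : Assignment) where
    open Assignment F

    start≤finish : ∀ S → start S ℚ.≤ finish S
    start≤finish S = p≤p+fromℕ (start S) (cost S)

    -- Availability concerns all predecessors, the forest only records direct ones. Along a chain of
    -- scheduled sets completion times increase, so it suffices to look at the direct predecessor.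
    predecessors-completed :
      (∀ {P S} → S ∈ scheduled → P ≺₁ S → P ∈ scheduled × finish P ℚ.≤ start S) →
      ∀ {S t} → (∀ {P} → P ≺₁ S → P ∈ scheduled × finish P ℚ.≤ t) →
      ∀ {P} → P ≺ S → P ∈ scheduled × finish P ℚ.≤ t
    predecessors-completed ready₁ direct [ P≺S ] = direct P≺S
    predecessors-completed ready₁ direct (P≺Q ∷ Q≺S)
      with predecessors-completed ready₁ direct Q≺S
    ... | Q∈ , fQ≤t with ready₁ Q∈ P≺Q
    ...   | P∈ , fP≤sQ = P∈ , ℚ.≤-trans fP≤sQ (ℚ.≤-trans (start≤finish _) fQ≤t)

  -- At a time when neither p nor the chain of predecessors of S is busy, the next set of the chain would be
  -- available; so the sets on p and the chain cover all times before S finishes.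
  finish≤rootDist+load : ∀ {𝒞 F} → IsListSchedule 𝒞 F → let open Assignment F in
    ∀ p {S} → S ∈ 𝒞 → finish S ℚ.≤ fromℕ (rootDist S + weight cost (𝒞 ∩ fibre machine p))
  finish≤rootDist+load {𝒞} {F} record { family = refl ; ready = ready ; greedy = greedy } p {S} S∈ =
    let Q , wQ , covers = chain-covers tree start finish 𝒞 Busy (λ S∈ P≺S → proj₁ (ready S∈ [ P≺S ])) waiting S∈
    in begin
    finish S
      ≤⟨ Intervals.cover-length start cost (Q ∪ onMachine) (λ 0≤t t<f → union Q (covers 0≤t t<f)) ⟩
    0ℚ ℚ.+ fromℕ (weight cost (Q ∪ onMachine))   ≡⟨ ℚ.+-identityˡ (fromℕ (weight cost (Q ∪ onMachine))) ⟩
    fromℕ (weight cost (Q ∪ onMachine))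
      ≤⟨ fromℕ-mono-≤ (ℕ.≤-trans (weight-∪ cost Q onMachine) (ℕ.+-monoˡ-≤ (weight cost onMachine) wQ)) ⟩
    fromℕ (rootDist S + weight cost onMachine)   ∎
    where
    open Assignment F
    open ℚ.≤-Reasoning hiding (start)

    onMachine : Subset k
    onMachine = 𝒞 ∩ fibre machine p

    Busy : ℚ → Set
    Busy t = ∃[ J ] J ∈ 𝒞 × machine J ≡ p × start J ℚ.≤ t × t ℚ.< finish J

    busy? : ∀ t → Dec (Busy t)
    busy? t = any? λ J → (J ∈? 𝒞) ×-dec (machine J Fin.≟ p) ×-dec (start J ℚ.≤? t) ×-dec (t ℚ.<? finish J)

    waiting : ∀ {S t} → S ∈ 𝒞 → 0ℚ ℚ.≤ t → t ℚ.< start S →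
              (∀ {P} → P ≺₁ S → P ∈ 𝒞 × finish P ℚ.≤ t) → Busy t
    -- `Idle` is a negation, so greediness only refutes idleness; a busy set is extracted because
    -- finitely many sets can be tested.
    waiting S∈ 0≤t t<s direct = decidable-stable (busy? _) λ idle →
      ℚ.<-irrefl refl (ℚ.<-≤-trans t<s (greedy 0≤t idle S∈
        (predecessors-completed F (λ S∈ P≺S → ready S∈ [ P≺S ]) direct)))

    union : ∀ Q {t} → (∃[ J ] J ∈ Q × start J ℚ.≤ t × t ℚ.< finish J) ⊎ Busy t →
            ∃[ J ] J ∈ Q ∪ onMachine × start J ℚ.≤ t × t ℚ.< finish J
    union Q (inj₁ (J , J∈Q , J∋t))        = J , x∈p∪q⁺ (inj₁ J∈Q) , J∋t
    union Q (inj₂ (J , J∈ , refl , J∋t)) = J , x∈p∪q⁺ (inj₂ (x∈p∩q⁺ (J∈ , ∈-fibre⁺ machine J))) , J∋t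

  -- Existence of List-Schedules, by simulation in integral time

  module Construction (𝒞 : Subset k) (closed : ∀ {P S} → S ∈ 𝒞 → P ≺₁ S → P ∈ 𝒞) where

    -- State of a tick-by-tick simulation in which everything before time τ is settled.
    record Partial (τ : ℕ) : Set where
      field
        D       : Subset k
        D⊆𝒞     : D ⊆ 𝒞
        machine : Fin k → Fin m
        start   : Fin k → ℕ

      finish : Fin k → ℕ
      finish S = start S + cost S

      Busy : Fin m → ℚ → Set
      Busy p t = ∃[ J ] J ∈ D × machine J ≡ p × fromℕ (start J) ℚ.≤ t × t ℚ.< fromℕ (finish J)

      field
        start≤τ  : ∀ {S} → S ∈ D → start S ≤ τ
        disjoint : ∀ {S₁ S₂} → S₁ ∈ D → S₂ ∈ D → S₁ ≢ S₂ → machine S₁ ≡ machine S₂ →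
                   finish S₁ ≤ start S₂ ⊎ finish S₂ ≤ start S₁
        ready    : ∀ {P S} → S ∈ D → P ≺₁ S → P ∈ D × finish P ≤ start S
        -- t ranges over rational times, so that in the end this yields the condition of
        -- `IsListSchedule`. As D may be incomplete, the conclusion also asserts that S has been
        -- placed.
        greedy   : ∀ {S p t} → 0ℚ ℚ.≤ t → t ℚ.< fromℕ τ → ¬ Busy p t → S ∈ 𝒞 →
                   (∀ {P} → P ≺₁ S → P ∈ D × fromℕ (finish P) ℚ.≤ t) →
                   S ∈ D × fromℕ (start S) ℚ.≤ t

      Occupied : Fin m → Set
      Occupied p = ∃[ J ] J ∈ D × machine J ≡ p × τ < finish J

      Ready : Fin k → Set
      Ready S = ∀ P → P ≺₁ S → P ∈ D × finish P ≤ τ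

      Startable : Fin k → Fin m → Set
      Startable S p = S ∈ 𝒞 × S ∉ D × Ready S × ¬ Occupied p

      occupied? : ∀ p → Dec (Occupied p)
      occupied? p = any? λ J → (J ∈? D) ×-dec (machine J Fin.≟ p) ×-dec (τ ℕ.<? finish J)

      ready? : ∀ S → Dec (Ready S)
      ready? S = all? λ P → Maybe.≡-dec Fin._≟_ (directPred S) (just P) →-dec ((P ∈? D) ×-dec (finish P ≤? τ))

      startable? : Dec (∃[ S ] ∃[ p ] Startable S p)
      startable? = any? λ S → any? λ p → (S ∈? 𝒞) ×-dec ¬? (S ∈? D) ×-dec ready? S ×-dec ¬? (occupied? p)

    -- All starting and finishing times are integers, so nothing changes between τ and τ + 1: a
    -- violation of greediness in that interval would already be a startable set at τ.
    tick : ∀ {τ} (s : Partial τ) → let open Partial s in ¬ (∃[ S ] ∃[ p ] Startable S p) → Partial (suc τ)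
    tick {τ} s stuck = record
      { D = D ; D⊆𝒞 = D⊆𝒞 ; machine = machine ; start = start
      ; start≤τ = ℕ.m≤n⇒m≤1+n ∘ start≤τ ; disjoint = disjoint ; ready = ready
      ; greedy = greedy′
      }
      where
      open Partial s
      greedy′ : ∀ {S p t} → 0ℚ ℚ.≤ t → t ℚ.< fromℕ (suc τ) → ¬ Busy p t → S ∈ 𝒞 →
                (∀ {P} → P ≺₁ S → P ∈ D × fromℕ (finish P) ℚ.≤ t) →
                S ∈ D × fromℕ (start S) ℚ.≤ t
      greedy′ {S} {p} {t} 0≤t t<τ+1 idle S∈ preds with t ℚ.<? fromℕ τ
      ... | yes t<τ = greedy 0≤t t<τ idle S∈ preds
      ... | no t≮τ with S ∈? D
      ...   | yes S∈D = S∈D , ℚ.≤-trans (fromℕ-mono-≤ (start≤τ S∈D)) (ℚ.≮⇒≥ t≮τ)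
      ...   | no S∉D = contradiction (S , p , S∈ , S∉D , ready-τ , free) stuck
        where
        ready-τ : Ready S
        ready-τ P P≺S with preds P≺S
        -- Integrality: a finishing time below τ + 1 is at most τ.
        ... | P∈ , fP≤t = P∈ , ℕ.≤-pred (fromℕ-cancel-< (ℚ.≤-<-trans fP≤t t<τ+1))
        free : ¬ Occupied p
        free (J , J∈ , mJ , τ<fJ) = idle (J , J∈ , mJ
          , ℚ.≤-trans (fromℕ-mono-≤ (start≤τ J∈)) (ℚ.≮⇒≥ t≮τ)
          , ℚ.<-≤-trans t<τ+1 (fromℕ-mono-≤ τ<fJ))

    module _ {τ} (s : Partial τ) {S p} (startable : Partial.Startable s S p) where
      open Partial s

      private
        S∈ : S ∈ 𝒞
        S∈ = proj₁ startable
        S∉D : S ∉ D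
        S∉D = proj₁ (proj₂ startable)
        S-ready : Ready S
        S-ready = proj₁ (proj₂ (proj₂ startable))
        free : ¬ Occupied p
        free = proj₂ (proj₂ (proj₂ startable))

        D′ : Subset k
        D′ = ⁅ S ⁆ ∪ D
        machine′ : Fin k → Fin m
        machine′ = updateAt machine S (const p)
        start′ : Fin k → ℕ
        start′ = updateAt start S (const τ)
        finish′ : Fin k → ℕ
        finish′ J = start′ J + cost J

        -- `updateAt` does not reduce at a variable index; this view replaces the case distinction
        -- on J = S and carries the resulting equations.
        data View : Fin k → Set where
          new : View S
          old : ∀ {J} → J ∈ D → machine′ J ≡ machine J → start′ J ≡ start J → View J

        machine′-S : machine′ S ≡ p
        machine′-S = updateAt-updates S machine
        start′-S : start′ S ≡ τ
        start′-S = updateAt-updates S start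

        D⊆D′ : D ⊆ D′
        D⊆D′ = q⊆p∪q ⁅ S ⁆ D

        old-∈ : ∀ {J} → J ∈ D → View J
        old-∈ {J} J∈D = old J∈D (updateAt-minimal J S machine J≢S) (updateAt-minimal J S start J≢S)
          where
          J≢S : J ≢ S
          J≢S refl = S∉D J∈D

        view : ∀ {J} → J ∈ D′ → View J
        view {J} J∈ with x∈p∪q⁻ ⁅ S ⁆ D J∈
        ... | inj₁ J∈S rewrite x∈⁅y⁆⇒x≡y S J∈S = new
        ... | inj₂ J∈D = old-∈ J∈D

        finish-old : ∀ {J} → J ∈ D → finish′ J ≡ finish J
        finish-old {J} J∈D with old-∈ J∈D
        ... | new = contradiction J∈D S∉D
        ... | old _ _ s≡ = cong (_+ cost J) s≡

      add : Partial τ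
      add = record
        { D = D′ ; D⊆𝒞 = λ J∈ → D′⊆𝒞 (view J∈) ; machine = machine′ ; start = start′
        ; start≤τ = λ J∈ → start≤ (view J∈)
        ; disjoint = λ J∈ L∈ → disjoint′ (view J∈) (view L∈)
        ; ready = λ J∈ → ready′ (view J∈)
        ; greedy = greedy′
        }
        where
        D′⊆𝒞 : ∀ {J} → View J → J ∈ 𝒞
        D′⊆𝒞 new           = S∈
        D′⊆𝒞 (old J∈D _ _) = D⊆𝒞 J∈D

        start≤ : ∀ {J} → View J → start′ J ≤ τ
        start≤ new = ℕ.≤-reflexive start′-S
        start≤ (old J∈D _ s≡) = subst (_≤ τ) (sym s≡) (start≤τ J∈D)

        finish≤start-S : ∀ {J} → J ∈ D → machine J ≡ p → finish′ J ≤ start′ S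
        finish≤start-S {J} J∈D mJ≡p = subst₂ _≤_ (sym (finish-old J∈D)) (sym start′-S)
          (ℕ.≮⇒≥ λ τ<fJ → free (J , J∈D , mJ≡p , τ<fJ))

        disjoint′ : ∀ {J L} → View J → View L → J ≢ L → machine′ J ≡ machine′ L →
                    finish′ J ≤ start′ L ⊎ finish′ L ≤ start′ J
        disjoint′ new new J≢L _ = contradiction refl J≢L
        disjoint′ new (old L∈D m≡ _) _ eq =
          inj₂ (finish≤start-S L∈D (trans (sym m≡) (trans (sym eq) machine′-S)))
        disjoint′ (old J∈D m≡ _) new _ eq =
          inj₁ (finish≤start-S J∈D (trans (sym m≡) (trans eq machine′-S)))
        disjoint′ (old J∈D mJ sJ) (old L∈D mL sL) J≢L eq
          with disjoint J∈D L∈D J≢L (trans (sym mJ) (trans eq mL))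
        ... | inj₁ J≤L = inj₁ (subst₂ _≤_ (sym (finish-old J∈D)) (sym sL) J≤L)
        ... | inj₂ L≤J = inj₂ (subst₂ _≤_ (sym (finish-old L∈D)) (sym sJ) L≤J)

        ready′ : ∀ {P J} → View J → P ≺₁ J → P ∈ D′ × finish′ P ≤ start′ J
        ready′ {P} new P≺S with S-ready P P≺S
        ... | P∈D , fP≤τ = D⊆D′ P∈D , subst₂ _≤_ (sym (finish-old P∈D)) (sym start′-S) fP≤τ
        ready′ (old J∈D _ sJ) P≺J with ready J∈D P≺J
        ... | P∈D , fP≤sJ = D⊆D′ P∈D , subst₂ _≤_ (sym (finish-old P∈D)) (sym sJ) fP≤sJ

        greedy′ : ∀ {J q t} → 0ℚ ℚ.≤ t → t ℚ.< fromℕ τ →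
                  ¬ (∃[ L ] L ∈ D′ × machine′ L ≡ q × fromℕ (start′ L) ℚ.≤ t × t ℚ.< fromℕ (finish′ L)) →
                  J ∈ 𝒞 → (∀ {P} → P ≺₁ J → P ∈ D′ × fromℕ (finish′ P) ℚ.≤ t) →
                  J ∈ D′ × fromℕ (start′ J) ℚ.≤ t
        greedy′ {J} {q} {t} 0≤t t<τ idle J∈ preds = transfer (greedy 0≤t t<τ idle-old J∈ preds-old)
          where
          idle-old : ¬ Busy q t
          idle-old (L , L∈D , mL , s≤t , t<f) with old-∈ L∈D
          ... | new = S∉D L∈D
          ... | old _ m≡ s≡ = idle (L , D⊆D′ L∈D , trans m≡ mL
            , subst (λ x → fromℕ x ℚ.≤ t) (sym s≡) s≤t
            , subst (λ x → t ℚ.< fromℕ x) (sym (finish-old L∈D)) t<f)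

          preds-old : ∀ {P} → P ≺₁ J → P ∈ D × fromℕ (finish P) ℚ.≤ t
          preds-old {P} P≺J with preds P≺J
          ... | P∈ , f≤t with view P∈
          ...   | old P∈D _ _ = P∈D , subst (λ x → fromℕ x ℚ.≤ t) (finish-old P∈D) f≤t
          -- S starts at τ, hence cannot be a predecessor completed by a time t before τ.
          ...   | new = contradiction (ℚ.<-≤-trans t<τ (ℚ.≤-trans (fromℕ-mono-≤
                    (ℕ.≤-trans (ℕ.≤-reflexive (sym start′-S)) (ℕ.m≤m+n _ (cost S)))) f≤t)) (ℚ.<-irrefl refl)

          transfer : J ∈ D × fromℕ (start J) ℚ.≤ t → J ∈ D′ × fromℕ (start′ J) ℚ.≤ t
          transfer (J∈D , s≤t) with old-∈ J∈D
          ... | new = contradiction J∈D S∉D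
          ... | old _ _ s≡ = D⊆D′ J∈D , subst (λ x → fromℕ x ℚ.≤ t) (sym s≡) s≤t

      add-finish : ∀ {d} → (∀ {J} → J ∈ D → finish J ≤ τ + d) →
                   ∀ {J} → J ∈ Partial.D add → Partial.finish add J ≤ τ + (d + cost S)
      add-finish {d} bound J∈ = go (view J∈)
        where
        go : ∀ {J} → View J → finish′ J ≤ τ + (d + cost S)
        go new = ℕ.+-mono-≤ (ℕ.≤-reflexive start′-S) (ℕ.m≤n+m (cost S) d)
        go (old J∈D _ _) = ℕ.≤-trans (ℕ.≤-reflexive (finish-old J∈D))
          (ℕ.≤-trans (bound J∈D) (ℕ.+-monoʳ-≤ τ (ℕ.m≤m+n d (cost S))))

      add-size : suc ∣ D ∣ ≤ ∣ Partial.D add ∣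
      add-size = p⊂q⇒∣p∣<∣q∣ (D⊆D′ , S , p⊆p∪q D (x∈⁅x⁆ S) , S∉D)

    -- Climb from S as long as the direct predecessor is unscheduled; the set where this stops is
    -- ready, since everything placed is done. So the simulation cannot get stuck with all machines
    -- free.
    unscheduled-ready : ∀ {τ} (s : Partial τ) → let open Partial s in
      (∀ {J} → J ∈ D → finish J ≤ τ) → ∀ {S} → S ∈ 𝒞 → S ∉ D → ∃[ R ] R ∈ 𝒞 × R ∉ D × Ready R
    unscheduled-ready {τ} s done {S} = go S (≺₁-wellFounded S)
      where
      open Partial s
      go : ∀ S → Acc _≺₁_ S → S ∈ 𝒞 → S ∉ D → ∃[ R ] R ∈ 𝒞 × R ∉ D × Ready R
      go S (acc rs) S∈ S∉ with directPred S in eq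
      ... | nothing = S , S∈ , S∉ , λ P P≺S → contradiction (trans (sym P≺S) eq) λ ()
      ... | just P with P ∈? D
      ...   | no P∉  = go P (rs refl) (closed S∈ eq) P∉
      ...   | yes P∈ = S , S∈ , S∉ , λ R R≺S →
        subst (λ R → R ∈ D × finish R ≤ τ) (Maybe.just-injective (trans (sym eq) R≺S)) (P∈ , done P∈)

    -- Lexicographic termination: n bounds the number of unplaced sets and d the time until all
    -- placed sets are finished. Placing a set lowers n and may raise d, while a tick lowers d and
    -- keeps n.
    run : ∀ n d {τ} (s : Partial τ) → let open Partial s in
          ∣ 𝒞 ∣ ≤ n + ∣ D ∣ → (∀ {J} → J ∈ D → finish J ≤ τ + d) →
          ∃[ τ′ ] Σ[ s′ ∈ Partial τ′ ] 𝒞 ⊆ Partial.D s′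
    run n d {τ} s size bound with any? (λ S → (S ∈? 𝒞) ×-dec ¬? (S ∈? Partial.D s))
    ... | no complete = τ , s , 𝒞⊆D
      where
      𝒞⊆D : 𝒞 ⊆ Partial.D s
      𝒞⊆D {S} S∈ with S ∈? Partial.D s
      ... | yes S∈D = S∈D
      ... | no S∉D  = contradiction (S , S∈ , S∉D) complete
    ... | yes (S , S∈ , S∉) with Partial.startable? s
    -- With n = 0 the subfamily D is as large as 𝒞, so it cannot miss R.
    run zero d s size bound | yes _ | yes (R , p , R∈ , R∉ , _) =
      contradiction (p⊂q⇒∣p∣<∣q∣ (Partial.D⊆𝒞 s , R , R∈ , R∉)) (ℕ.≤⇒≯ size)
    run (suc n) d s size bound | yes _ | yes (R , p , startable) =
      run n (d + cost R) (add s startable)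
        (ℕ.≤-trans size (ℕ.≤-trans (ℕ.≤-reflexive (sym (ℕ.+-suc n _))) (ℕ.+-monoʳ-≤ n (add-size s startable))))
        (add-finish s startable bound)
    -- With d = 0 every machine is free at τ, so a ready set could start on any of them,
    -- contradicting `stuck`.
    run n zero {τ} s size bound | yes (S , S∈ , S∉) | no stuck
      with unscheduled-ready s (λ J∈ → ℕ.≤-trans (bound J∈) (ℕ.≤-reflexive (ℕ.+-identityʳ τ))) S∈ S∉
    ... | R , R∈ , R∉ , ready = contradiction (R , Fin.fromℕ< m>0 , R∈ , R∉ , ready ,
      λ { (J , J∈ , _ , τ<f) → ℕ.<⇒≱ τ<f (ℕ.≤-trans (bound J∈) (ℕ.≤-reflexive (ℕ.+-identityʳ τ))) }) stuck
    run n (suc d) {τ} s size bound | yes _ | no stuck =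
      run n d (tick s stuck) size (λ J∈ → ℕ.≤-trans (bound J∈) (ℕ.≤-reflexive (ℕ.+-suc τ d)))

    initial : Partial 0
    initial = record
      { D = ⊥ ; D⊆𝒞 = λ J∈ → contradiction J∈ ∉⊥ ; machine = λ _ → Fin.fromℕ< m>0 ; start = λ _ → 0
      ; start≤τ = λ _ → z≤n
      ; disjoint = λ J∈ → contradiction J∈ ∉⊥
      ; ready = λ J∈ → contradiction J∈ ∉⊥
      ; greedy = λ 0≤t t<0 → contradiction (ℚ.≤-<-trans 0≤t t<0) (ℚ.<-irrefl refl)
      }

    abstract
      complete : ∃[ τ ] Σ[ s ∈ Partial τ ] 𝒞 ⊆ Partial.D s
      complete = run ∣ 𝒞 ∣ 0 initial (ℕ.m≤m+n _ _) λ J∈ → contradiction J∈ ∉⊥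

    private
      τ = proj₁ complete
      open Partial (proj₁ (proj₂ complete))
      𝒞⊆D : 𝒞 ⊆ D
      𝒞⊆D = proj₂ (proj₂ complete)

    fromℕ-finish : ∀ S → fromℕ (finish S) ≡ fromℕ (start S) ℚ.+ fromℕ (cost S)
    fromℕ-finish S = fromℕ-+ (start S) (cost S)

    schedule : Nonempty 𝒞 → Assignment
    schedule ne = record
      { scheduled  = 𝒞
      ; nonempty   = ne
      ; machine    = machine
      ; start      = fromℕ ∘ start
      ; start≥0    = λ {S} _ → 0≤fromℕ (start S)
      ; no-overlap = separated
      }
      where
      mono : ∀ {S₁ S₂} → finish S₁ ≤ start S₂ → fromℕ (start S₁) ℚ.+ fromℕ (cost S₁) ℚ.≤ fromℕ (start S₂)
      mono {S₁} {S₂} f≤s = subst (ℚ._≤ fromℕ (start S₂)) (fromℕ-finish S₁) (fromℕ-mono-≤ f≤s)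
      separated : ∀ {S₁ S₂} → S₁ ∈ 𝒞 → S₂ ∈ 𝒞 → S₁ ≢ S₂ → machine S₁ ≡ machine S₂ →
                fromℕ (start S₁) ℚ.+ fromℕ (cost S₁) ℚ.≤ fromℕ (start S₂) ⊎
                fromℕ (start S₂) ℚ.+ fromℕ (cost S₂) ℚ.≤ fromℕ (start S₁)
      separated S₁∈ S₂∈ S₁≢S₂ eq with disjoint (𝒞⊆D S₁∈) (𝒞⊆D S₂∈) S₁≢S₂ eq
      ... | inj₁ f≤s = inj₁ (mono f≤s)
      ... | inj₂ f≤s = inj₂ (mono f≤s)

    schedule-isListSchedule : ∀ ne → IsListSchedule 𝒞 (schedule ne)
    schedule-isListSchedule ne = record
      { family = refl
      ; ready  = λ S∈ → predecessors-completed (schedule ne) ready₁ (ready₁ S∈)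
      ; greedy = greedy′
      }
      where
      module A = Assignment (schedule ne)
      ready₁ : ∀ {P S} → S ∈ 𝒞 → P ≺₁ S → P ∈ 𝒞 × A.finish P ℚ.≤ A.start S
      ready₁ {P} {S} S∈ P≺S with ready (𝒞⊆D S∈) P≺S
      ... | P∈ , f≤s = D⊆𝒞 P∈ , subst (ℚ._≤ fromℕ (start S)) (fromℕ-finish P) (fromℕ-mono-≤ f≤s)

      greedy′ : ∀ {S p t} → 0ℚ ℚ.≤ t → A.Idle p t → S ∈ 𝒞 →
                (∀ {P} → P ≺ S → P ∈ 𝒞 × A.finish P ℚ.≤ t) → A.start S ℚ.≤ t
      greedy′ {S} {p} {t} 0≤t idle S∈ available with t ℚ.<? fromℕ τ
      ... | no t≮τ  = ℚ.≤-trans (fromℕ-mono-≤ (start≤τ (𝒞⊆D S∈))) (ℚ.≮⇒≥ t≮τ)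
      ... | yes t<τ = proj₂ (greedy 0≤t t<τ
        (λ (J , J∈ , mJ , s≤t , t<f) → idle (J , D⊆𝒞 J∈ , mJ , s≤t , subst (t ℚ.<_) (fromℕ-finish J) t<f))
        S∈
        (λ {P} P≺S → let P∈ , f≤t = available [ P≺S ] in
          𝒞⊆D P∈ , subst (ℚ._≤ t) (sym (fromℕ-finish P)) f≤t))

-- The approximation guarantee

÷-*-cancel : ∀ p q .{{_ : ℚ.NonZero q}} → (p ℚ.÷ q) ℚ.* q ≡ p
÷-*-cancel p q = trans (ℚ.*-assoc p _ q) (trans (cong (p ℚ.*_) (ℚ.*-inverseˡ q)) (ℚ.*-identityʳ p))

1/-positive : ∀ q .{{q≢0 : ℚ.NonZero q}} → 0ℚ ℚ.< q → ℚ.Positive ((ℚ.1/ q) {{q≢0}})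
1/-positive q {{q≢0}} 0<q = ℚ.1/pos⇒pos q {{ℚ.positive 0<q}}

p≤c*q⇒p÷q≤c : ∀ {p c} q .{{_ : ℚ.NonZero q}} → 0ℚ ℚ.< q → p ℚ.≤ c ℚ.* q → p ℚ.÷ q ℚ.≤ c
p≤c*q⇒p÷q≤c {p} {c} q 0<q p≤c*q = begin
  p ℚ.* (ℚ.1/ q)              ≤⟨ ℚ.*-monoʳ-≤-nonNeg (ℚ.1/ q) {{1/q≥0}} p≤c*q ⟩
  c ℚ.* q ℚ.* (ℚ.1/ q)        ≡⟨ ℚ.*-assoc c q _ ⟩
  c ℚ.* (q ℚ.* (ℚ.1/ q))      ≡⟨ cong (c ℚ.*_) (ℚ.*-inverseʳ q) ⟩
  c ℚ.* ℚ.1ℚ                  ≡⟨ ℚ.*-identityʳ c ⟩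
  c                           ∎
  where
  open ℚ.≤-Reasoning
  1/q≥0 : ℚ.NonNegative (ℚ.1/ q)
  1/q≥0 = ℚ.pos⇒nonNeg (ℚ.1/ q) {{1/-positive q 0<q}}

0≤p*q : ∀ {p q} → 0ℚ ℚ.≤ p → 0ℚ ℚ.≤ q → 0ℚ ℚ.≤ p ℚ.* q
0≤p*q {p} {q} 0≤p 0≤q = ℚ.nonNegative⁻¹ (p ℚ.* q)
  {{ℚ.nonNeg*nonNeg⇒nonNeg p {{ℚ.nonNegative 0≤p}} q {{ℚ.nonNegative 0≤q}}}}

0≤p÷q : ∀ {p q} .{{_ : ℚ.NonZero q}} → 0ℚ ℚ.≤ p → 0ℚ ℚ.< q → 0ℚ ℚ.≤ p ℚ.÷ q
0≤p÷q {p} {q} 0≤p 0<q = 0≤p*q 0≤p (ℚ.<⇒≤ (ℚ.positive⁻¹ (ℚ.1/ q) {{1/-positive q 0<q}}))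

-- A loss c in weight and a stretch r in length multiply to a loss c r in density.
÷-mono : ∀ {a b c r} L L′ .{{_ : ℚ.NonZero L}} .{{_ : ℚ.NonZero L′}} → 0ℚ ℚ.< L → 0ℚ ℚ.< L′ →
         0ℚ ℚ.≤ b → 0ℚ ℚ.≤ c → a ℚ.≤ c ℚ.* b → L′ ℚ.≤ r ℚ.* L →
         a ℚ.÷ L ℚ.≤ c ℚ.* r ℚ.* (b ℚ.÷ L′)
÷-mono {a} {b} {c} {r} L L′ 0<L 0<L′ 0≤b 0≤c a≤cb L′≤rL = p≤c*q⇒p÷q≤c L 0<L (begin
  a                                     ≤⟨ a≤cb ⟩
  c ℚ.* b                               ≡⟨ cong (c ℚ.*_) (÷-*-cancel b L′) ⟨
  c ℚ.* (y ℚ.* L′)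
    ≤⟨ ℚ.*-monoˡ-≤-nonNeg c {{ℚ.nonNegative 0≤c}}
       (ℚ.*-monoˡ-≤-nonNeg y {{ℚ.nonNegative (0≤p÷q 0≤b 0<L′)}} L′≤rL) ⟩
  c ℚ.* (y ℚ.* (r ℚ.* L))               ≡⟨ cong (c ℚ.*_) (ℚ.*-assoc y r L) ⟨
  c ℚ.* (y ℚ.* r ℚ.* L)                 ≡⟨ cong (λ x → c ℚ.* (x ℚ.* L)) (ℚ.*-comm y r) ⟩
  c ℚ.* (r ℚ.* y ℚ.* L)                 ≡⟨ ℚ.*-assoc c _ L ⟨
  c ℚ.* (r ℚ.* y) ℚ.* L                 ≡⟨ cong (ℚ._* L) (ℚ.*-assoc c r y) ⟨
  c ℚ.* r ℚ.* y ℚ.* L                   ∎)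
  where
  open ℚ.≤-Reasoning
  y = b ℚ.÷ L′

-- The assignment of a budget also takes a proof that its collection is non-empty; `irrelevant` lets
-- one proof per index stand for all of them.
argmax : ∀ {n} {P : Fin n → Set} (P? : ∀ i → Dec (P i)) (f : ∀ i → P i → ℚ) → (∀ i p q → f i p ≡ f i q) →
         ∃[ i ] P i → ∃[ i ] ∃[ p ] (∀ j q → f j q ℚ.≤ f i p)
argmax {suc n} {P} P? f irrelevant (i₀ , p₀) with any? (P? ∘ suc) | P? zero
... | no ¬any | no ¬p = contradiction p₀ (λ p → impossible i₀ p)
  where
  impossible : ∀ i → ¬ P i
  impossible zero    = ¬p
  impossible (suc i) = λ p → ¬any (i , p)
... | no ¬any | yes p = zero , p , λ
  { zero    q → ℚ.≤-reflexive (irrelevant zero q p)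
  ; (suc j) q → contradiction (j , q) ¬any }
... | yes any | d with argmax (P? ∘ suc) (f ∘ suc) (irrelevant ∘ suc) any | d
...   | i , p , f≤ | no ¬p = suc i , p , λ { zero q → contradiction q ¬p ; (suc j) q → f≤ j q }
...   | i , p , f≤ | yes p′ with f zero p′ ℚ.≤? f (suc i) p
...     | yes z≤s = suc i , p , λ
  { zero    q → ℚ.≤-trans (ℚ.≤-reflexive (irrelevant zero q p′)) z≤s ; (suc j) q → f≤ j q }
...     | no z≰s  = zero , p′ , λ
  { zero    q → ℚ.≤-reflexive (irrelevant zero q p′)
  ; (suc j) q → ℚ.≤-trans (f≤ j q) (ℚ.<⇒≤ (ℚ.≰⇒> z≰s)) }

-- Induction on the largest exponent: if L exceeds 2^N, then 2^(N+1) is still at most 2L. The second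
-- alternative serves lengths beyond all budgets.
power-of-2-within-factor-2 : ∀ {L} → fromℕ 1 ℚ.≤ L → ∀ N →
  (∃[ i ] i ≤ N × L ℚ.≤ fromℕ (2 ^ i) × fromℕ (2 ^ i) ℚ.≤ fromℕ 2 ℚ.* L) ⊎ fromℕ (2 ^ N) ℚ.≤ fromℕ 2 ℚ.* L
power-of-2-within-factor-2 {L} 1≤L zero = inj₂ (ℚ.≤-trans 1≤L (subst (ℚ._≤ fromℕ 2 ℚ.* L) (ℚ.*-identityˡ L)
  (ℚ.*-monoʳ-≤-nonNeg L {{ℚ.nonNegative (ℚ.≤-trans (0≤fromℕ 1) 1≤L)}} (fromℕ-mono-≤ {1} {2} (s≤s z≤n)))))
power-of-2-within-factor-2 {L} 1≤L (suc N) with power-of-2-within-factor-2 1≤L N | L ℚ.≤? fromℕ (2 ^ N)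
... | inj₁ (i , i≤N , bounds) | _      = inj₁ (i , ℕ.m≤n⇒m≤1+n i≤N , bounds)
... | inj₂ 2^N≤2L | yes L≤2^N = inj₁ (N , ℕ.n≤1+n N , L≤2^N , 2^N≤2L)
... | inj₂ _      | no L≰2^N  = inj₂ (subst (ℚ._≤ fromℕ 2 ℚ.* L) (sym (fromℕ-* 2 (2 ^ N)))
  (ℚ.*-monoˡ-≤-nonNeg (fromℕ 2) (ℚ.<⇒≤ (ℚ.≰⇒> L≰2^N))))

∈-⋃-map⁺ : ∀ {k n} (f : Fin k → Subset n) {S u} xs → S List.∈ xs → u ∈ f S → u ∈ ⋃ (map f xs)
∈-⋃-map⁺ f (x ∷ xs) (Any.here refl) u∈ = p⊆p∪q _ u∈
∈-⋃-map⁺ f (x ∷ xs) (Any.there S∈)  u∈ = q⊆p∪q (f x) _ (∈-⋃-map⁺ f xs S∈ u∈)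

∈-⋃-map⁻ : ∀ {k n} (f : Fin k → Subset n) {u} xs → u ∈ ⋃ (map f xs) → ∃[ S ] S List.∈ xs × u ∈ f S
∈-⋃-map⁻ f []       u∈ = contradiction u∈ ∉⊥
∈-⋃-map⁻ f (x ∷ xs) u∈ with x∈p∪q⁻ (f x) _ u∈
... | inj₁ u∈x  = x , Any.here refl , u∈x
... | inj₂ u∈xs = let S , S∈ , u∈S = ∈-⋃-map⁻ f xs u∈xs in S , Any.there S∈ , u∈S

module _ {k} (I : PCPDS k) where
  open PCPDS I
  open OutForest precedence using (_≺₁_; directPred; ≺₁-wellFounded)
  open Scheduling I
  open RootedTree tree using (rootDist)

  ∈-cov⁺ : ∀ F {S u} → S ∈ Assignment.scheduled F → u ∈ set S → u ∈ Assignment.cov F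
  ∈-cov⁺ F {S} S∈ = ∈-⋃-map⁺ set _ (∈-filter⁺ (_∈? Assignment.scheduled F) (∈-allFin S) S∈)

  ∈-cov⁻ : ∀ F {u} → u ∈ Assignment.cov F → ∃[ S ] S ∈ Assignment.scheduled F × u ∈ set S
  ∈-cov⁻ F u∈ = let S , S∈ , u∈S = ∈-⋃-map⁻ set _ u∈ in
    S , proj₂ (∈-filter⁻ (_∈? Assignment.scheduled F) {xs = allFin k} S∈) , u∈S

  length≤ : ∀ F {b} → 0ℚ ℚ.≤ b → (∀ {S} → S ∈ Assignment.scheduled F → Assignment.finish F S ℚ.≤ b) →
            Assignment.length F ℚ.≤ b
  length≤ F 0≤b finish≤b = max≤v⁺ 0≤b (All.map⁺ (All.tabulate λ S∈ →
    finish≤b (proj₂ (∈-filter⁻ (_∈? Assignment.scheduled F) {xs = allFin k} S∈))))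

  density≥0 : ∀ F → 0ℚ ℚ.≤ density F
  density≥0 F = 0≤p÷q {{Assignment.length-nonZero F}}
    (0≤fromℕ (weight w (Assignment.cov F))) (Assignment.length>0 F)

  module _ (F : Assignment) (closed : IsPrecedenceClosed F) where
    open Assignment F

    cost≤finish : ∀ {S} → S ∈ scheduled → fromℕ (cost S) ℚ.≤ finish S
    cost≤finish {S} S∈ =
      subst (ℚ._≤ finish S) (ℚ.+-identityˡ (fromℕ (cost S))) (ℚ.+-monoˡ-≤ (fromℕ (cost S)) (start≥0 S∈))

    1≤length : fromℕ 1 ℚ.≤ length
    1≤length = let S , S∈ = nonempty in
      ℚ.≤-trans (fromℕ-mono-≤ (cost>0 S)) (ℚ.≤-trans (cost≤finish S∈) (finish≤length S∈))

    -- The sets on the path from the root to S run one after another, the first of them not before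
    -- time 0.
    rootDist≤finish : ∀ {S} → S ∈ scheduled → fromℕ (rootDist S) ℚ.≤ finish S
    rootDist≤finish {S} = go (≺₁-wellFounded S)
      where
      go : ∀ {S} → Acc _≺₁_ S → S ∈ scheduled → fromℕ (rootDist S) ℚ.≤ finish S
      go {S} (acc rs) S∈ = byPred (directPred S) refl
        where
        byPred : ∀ P → directPred S ≡ P → fromℕ (rootDist S) ℚ.≤ finish S
        byPred nothing  eq = subst (λ d → fromℕ d ℚ.≤ finish S) (sym (rootDist-root tree eq)) (cost≤finish S∈)
        byPred (just P) eq = begin
          fromℕ (rootDist S)                       ≡⟨ cong fromℕ (rootDist-child tree eq) ⟩
          fromℕ (cost S + rootDist P)              ≡⟨ fromℕ-+ (cost S) (rootDist P) ⟩
          fromℕ (cost S) ℚ.+ fromℕ (rootDist P)    ≡⟨ ℚ.+-comm (fromℕ (cost S)) (fromℕ (rootDist P)) ⟩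
          fromℕ (rootDist P) ℚ.+ fromℕ (cost S)
            ≤⟨ ℚ.+-monoˡ-≤ (fromℕ (cost S)) (go (rs eq) (proj₁ P-done)) ⟩
          finish P ℚ.+ fromℕ (cost S)              ≤⟨ ℚ.+-monoˡ-≤ (fromℕ (cost S)) (proj₂ P-done) ⟩
          finish S                                 ∎
          where
          open ℚ.≤-Reasoning hiding (start)
          P-done = closed S∈ [ eq ]

    rootDist≤ : ∀ {B S} → length ℚ.≤ fromℕ B → S ∈ scheduled → rootDist S ≤ B
    rootDist≤ L≤B S∈ = fromℕ-cancel-≤ (ℚ.≤-trans (rootDist≤finish S∈) (ℚ.≤-trans (finish≤length S∈) L≤B))

    -- The sets on one machine are disjoint intervals between 0 and B, so each of the m loads is at
    -- most B.
    totalCost≤m*B : ∀ {B} → length ℚ.≤ fromℕ B → weight cost scheduled ≤ m * B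
    totalCost≤m*B {B} L≤B = begin
      weight cost scheduled
        ≡⟨ ∑-weight-fibre cost machine scheduled ⟨
      ∑[ p < m ] weight cost (scheduled ∩ fibre machine p)       ≤⟨ sum-mono-≤ load≤B ⟩
      ∑[ p < m ] B                                               ≡⟨ sum-const m B ⟩
      m * B                                                      ∎
      where
      open ℕ.≤-Reasoning hiding (start)
      load≤B : ∀ p → weight cost (scheduled ∩ fibre machine p) ≤ B
      load≤B p = fromℕ-cancel-≤ (subst (ℚ._≤ fromℕ B) (ℚ.+-identityˡ (fromℕ (weight cost X)))
        (Intervals.packed-length start cost X record
          { a≤b      = 0≤fromℕ B
          ; a≤start  = λ S∈ → start≥0 (sched S∈)
          ; finish≤b = λ S∈ → ℚ.≤-trans (finish≤length (sched S∈)) L≤B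
          ; disjoint = λ S∈ R∈ S≢R → no-overlap (sched S∈) (sched R∈) S≢R (trans (onp S∈) (sym (onp R∈)))
          }))
        where
        X = scheduled ∩ fibre machine p
        sched : ∀ {S} → S ∈ X → S ∈ scheduled
        sched S∈ = proj₁ (x∈p∩q⁻ scheduled (fibre machine p) S∈)
        onp : ∀ {S} → S ∈ X → machine S ≡ p
        onp S∈ = ∈-fibre⁻ machine (proj₂ (x∈p∩q⁻ scheduled (fibre machine p) S∈))

  listSchedule-closed : ∀ {𝒞 F} → IsListSchedule 𝒞 F → IsPrecedenceClosed F
  listSchedule-closed record { family = refl ; ready = ready } S∈ = ready S∈

  listSchedule-length : ∀ {𝒞 F B D} → IsListSchedule 𝒞 F → (∀ {S} → S ∈ 𝒞 → rootDist S ≤ B) →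
                        weight cost 𝒞 ≤ m * D → Assignment.length F ℚ.≤ fromℕ (B + D)
  listSchedule-length {𝒞} {F} {B} {D} ls@record { family = refl } rootDist≤B cost≤ =
    -- p need not be the machine that runs S: `finish≤rootDist+load` holds for every machine, so one
    -- lightly loaded p bounds all finishing times.
    let p , load≤D = average m>0 (λ p → weight cost (𝒞 ∩ fibre machine p))
                       (ℕ.≤-trans (ℕ.≤-reflexive (∑-weight-fibre cost machine 𝒞)) cost≤)
    in length≤ F (0≤fromℕ (B + D)) λ S∈ →
         ℚ.≤-trans (finish≤rootDist+load ls p S∈) (fromℕ-mono-≤ (ℕ.+-mono-≤ (rootDist≤B S∈) load≤D))
    where open Assignment F using (machine)

-- FOREST-DENSE budget by budget

module Analysis (a : ℕ → ℕ) (b : ℕ) (gso : GSOAlgorithm) (approx : IsBicriteriaApproximation a b gso)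
                {k} (I : PCPDS k) where
  open PCPDS I
  open ForestDense gso I
  open OutForest precedence using (_≺₁_)
  open RootedTree T using (rootDist)
  open Scheduling I using (module Construction)

  module _ (i : Budget) where
    B : ℕ
    B = 2 ^ toℕ i

    G : GSOInstance k n
    G = gsoInstance B

    open GSOInstance G using (V; Tour; visited; coveredGroups; coveredWeight; group)
    open Tours G

    gsoWeight : ℕ
    gsoWeight = coveredWeight (gso G)

    within? : ∀ S → Dec (rootDist S ≤ B)
    within? S = rootDist S ≤? B

    collection-closed : ∀ {P S} → S ∈ collection i → P ≺₁ S → P ∈ collection i
    collection-closed {P} S∈ eq = ∈-tail⁺ (subst (_∈ visited (gso G)) (cong (maybe suc zero) eq)
      (visited-parent (gso G) (∈-tail⁻ S∈)))

    collection-rootDist : ∀ {S} → S ∈ collection i → rootDist S ≤ B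
    collection-rootDist S∈ = ∈-subset⁻ within? (∈-tail⁺ (visited⊆V (gso G) (∈-tail⁻ S∈)))

    collection-cost : weight cost (collection i) ≤ a ∣ V ∣ * (2 * m * B)
    collection-cost = ℕ.≤-trans (weight-visited≤walkLength (gso G)) (proj₁ (approx G))

    covered⁺ : ∀ (τ : Tour) {S u} → suc S ∈ visited τ → u ∈ set S → u ∈ coveredGroups τ
    covered⁺ τ {S} S∈ u∈S = ∈-subset⁺ (λ u → nonempty? (group u ∩ visited τ))
      (suc S , x∈p∩q⁺ (x∈p∩q⁺ (there (∈-subset⁺ (λ S → _ ∈? set S) u∈S) , visited⊆V τ S∈) , S∈))

    covered⁻ : ∀ (τ : Tour) {u} → u ∈ coveredGroups τ → ∃[ S ] suc S ∈ visited τ × u ∈ set S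
    covered⁻ τ {u} u∈ with ∈-subset⁻ (λ u → nonempty? (group u ∩ visited τ)) u∈
    ... | x , x∈ with x∈p∩q⁻ (group u) (visited τ) x∈
    ...   | x∈u , x∈τ with x∈p∩q⁻ (X u) V x∈u
    ...     | there S∈ , _ = _ , x∈τ , ∈-subset⁻ (λ S → u ∈? set S) S∈

    -- The 2 in the budget 2mB pays for walking every edge of an Euler tour both ways. 𝒮 and U are
    -- arbitrary because the lemma serves both F* and, at the largest budget, the family of all
    -- sets.
    gsoWeight≥ : ∀ (𝒮 : Subset k) (U : Subset n) → (∀ {P S} → S ∈ 𝒮 → P ≺₁ S → P ∈ 𝒮) →
                 (∀ {S} → S ∈ 𝒮 → rootDist S ≤ B) → weight cost 𝒮 ≤ m * B →
                 (∀ {u} → u ∈ U → ∃[ S ] S ∈ 𝒮 × u ∈ set S) → weight w U ≤ b * gsoWeight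
    gsoWeight≥ 𝒮 U closed near cheap U-covered =
      let τ , short , visits = euler-tour 𝒮 closed (λ S∈ → there (∈-subset⁺ within? (near S∈)))
      in ℕ.≤-trans
        (weight-mono w {U} {coveredGroups τ} λ u∈ →
          let S , S∈ , u∈S = U-covered u∈ in covered⁺ τ (visits S∈) u∈S)
        (feasible-bound (proj₂ (approx G)) τ
          (ℕ.≤-trans short (ℕ.≤-trans (ℕ.*-monoʳ-≤ 2 cheap) (ℕ.≤-reflexive (sym (ℕ.*-assoc 2 m B))))))

    gsoWeight>0⇒nonempty : 0 < gsoWeight → Nonempty (collection i)
    gsoWeight>0⇒nonempty pos =
      let u , u∈ = weight>0⇒nonempty w (coveredGroups (gso G)) pos
          S , S∈ , _ = covered⁻ (gso G) u∈
      in S , ∈-tail⁺ S∈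

    gsoWeight≤cov : ∀ {F} → IsListSchedule (collection i) F → gsoWeight ≤ weight w (Assignment.cov F)
    gsoWeight≤cov {F} ls = weight-mono w {coveredGroups (gso G)} {Assignment.cov F} λ u∈ →
      let S , S∈ , u∈S = covered⁻ (gso G) u∈
      in ∈-cov⁺ I F (subst (S ∈_) (sym (IsListSchedule.family ls)) (∈-tail⁺ S∈)) u∈S

  lastBudget : Budget
  lastBudget = Fin.fromℕ< (ℕ.n<1+n ⌈log₂ (m * totalCost) ⌉)

  B-last : B lastBudget ≡ 2 ^ ⌈log₂ (m * totalCost) ⌉
  B-last = cong (2 ^_) (Fin.toℕ-fromℕ< (ℕ.n<1+n ⌈log₂ (m * totalCost) ⌉))

  m*totalCost≤B-last : m * totalCost ≤ B lastBudget
  m*totalCost≤B-last = ℕ.≤-trans (n≤2^⌈log₂n⌉ (m * totalCost)) (ℕ.≤-reflexive (sym B-last))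

  totalCost≤B-last : totalCost ≤ B lastBudget
  totalCost≤B-last = ℕ.≤-trans (ℕ.m≤n*m totalCost m {{>-nonZero m>0}}) m*totalCost≤B-last

  rootDist≤B-last : ∀ {S} → rootDist S ≤ B lastBudget
  rootDist≤B-last = ℕ.≤-trans (rootDist≤weight T ⊤ ∈⊤ (λ _ → ∈⊤))
    (ℕ.≤-trans (ℕ.≤-reflexive (weight-⊤ cost)) totalCost≤B-last)

  cost≤m*B-last : ∀ 𝒮 → weight cost 𝒮 ≤ m * B lastBudget
  cost≤m*B-last 𝒮 = ℕ.≤-trans (weight-mono cost {𝒮} {⊤} (λ _ → ∈⊤))
    (ℕ.≤-trans (ℕ.≤-reflexive (weight-⊤ cost))
      (ℕ.≤-trans totalCost≤B-last (ℕ.m≤n*m (B lastBudget) m {{>-nonZero m>0}})))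

  weight-universe>0 : 0 < weight w ⊤
  weight-universe>0 = ℕ.<-≤-trans (w>0 u)
    (ℕ.≤-trans (ℕ.m≤m+n (w u) _) (ℕ.≤-reflexive (sym (weight-remove w (∈⊤ {x = u})))))
    where u = Fin.fromℕ< n>0

  -- At the largest budget a tour of all sets is feasible and covers the universe, whose weight is
  -- positive; an approximate tour therefore covers something. So at least one budget yields an
  -- assignment to return.
  last-nonempty : Nonempty (collection lastBudget)
  last-nonempty = gsoWeight>0⇒nonempty lastBudget (ℕ.n≢0⇒n>0 λ zero-weight → ℕ.<⇒≱ weight-universe>0
    (ℕ.≤-trans (gsoWeight≥ lastBudget ⊤ ⊤ (λ _ _ → ∈⊤) (λ _ → rootDist≤B-last) (cost≤m*B-last ⊤)
                  (λ {u} _ → let S , u∈S = set-covers u in S , ∈⊤ , u∈S))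
      (ℕ.≤-reflexive (trans (cong (b *_) zero-weight) (ℕ.*-zeroʳ b)))))

  run : Run
  run = record
    { 𝓕             = λ i → Construction.schedule (collection i) (collection-closed i)
    ; listScheduled = λ i → Construction.schedule-isListSchedule (collection i) (collection-closed i)
    }

  returns : ∃[ F ] Returns F
  returns =
    let i , ne , best = argmax (λ i → nonempty? (collection i)) (λ i ne → density (Run.𝓕 run i ne))
                          (λ _ _ _ → refl) (lastBudget , last-nonempty)
    in Run.𝓕 run i ne , run , (i , ne , refl) , best

  matching-budget : ∀ F* → IsPrecedenceClosed F* → let open Assignment F* in
    ∃[ i ] fromℕ (B i) ℚ.≤ fromℕ 2 ℚ.* length × weight w cov ≤ b * gsoWeight i
  matching-budget F* closed =
    [ (λ (i , i≤ , L≤2^i , 2^i≤2L) → small i (s≤s i≤) L≤2^i 2^i≤2L)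
    -- F* may idle beyond all budgets; then the largest budget suits, as it already exceeds the
    -- total cost and hence every distance.
    , (λ last≤2L → lastBudget , subst (λ x → fromℕ x ℚ.≤ fromℕ 2 ℚ.* length) (sym B-last) last≤2L
        , heavy lastBudget (λ _ → rootDist≤B-last) (cost≤m*B-last scheduled)) ]′
    (power-of-2-within-factor-2 (1≤length I F* closed) ⌈log₂ (m * totalCost) ⌉)
    where
    open Assignment F*

    heavy : ∀ i → (∀ {S} → S ∈ scheduled → rootDist S ≤ B i) → weight cost scheduled ≤ m * B i →
            weight w cov ≤ b * gsoWeight i
    heavy i near cheap =
      gsoWeight≥ i scheduled cov (λ S∈ P≺S → proj₁ (closed S∈ [ P≺S ])) near cheap (∈-cov⁻ I F*)

    small : ∀ i → i < suc ⌈log₂ (m * totalCost) ⌉ → length ℚ.≤ fromℕ (2 ^ i) →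
            fromℕ (2 ^ i) ℚ.≤ fromℕ 2 ℚ.* length →
            ∃[ i ] fromℕ (B i) ℚ.≤ fromℕ 2 ℚ.* length × weight w cov ≤ b * gsoWeight i
    small i i< L≤ ≤2L = j , subst (λ x → fromℕ x ℚ.≤ fromℕ 2 ℚ.* length) (sym Bj≡) ≤2L
      , heavy j (rootDist≤ I F* closed L≤Bj) (totalCost≤m*B I F* closed L≤Bj)
      where
      j : Budget
      j = Fin.fromℕ< i<
      Bj≡ : B j ≡ 2 ^ i
      Bj≡ = cong (2 ^_) (Fin.toℕ-fromℕ< i<)
      L≤Bj : length ℚ.≤ fromℕ (B j)
      L≤Bj = subst (λ x → length ℚ.≤ fromℕ x) (sym Bj≡) L≤

-- Passing from the ceiling at n + 1 to the floor at n costs exactly 1, which n ≥ 2 absorbs since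
-- then ⌊log₂ n⌋ ≥ 1.
⌈log₂[1+n]⌉≤2⌊log₂n⌋ : ∀ {n} → 2 ≤ n → ⌈log₂ (suc n) ⌉ ≤ 2 * ⌊log₂ n ⌋
⌈log₂[1+n]⌉≤2⌊log₂n⌋ {suc n} 2≤n = begin
  ⌈log₂ (suc (suc n)) ⌉              ≡⟨ ⌈log₂[1+n]⌉≡1+⌊log₂n⌋ (suc n) ⟩
  1 + ⌊log₂ (suc n) ⌋                ≤⟨ ℕ.+-monoˡ-≤ ⌊log₂ (suc n) ⌋ (⌊log₂⌋-mono-≤ 2≤n) ⟩
  ⌊log₂ (suc n) ⌋ + ⌊log₂ (suc n) ⌋  ≡⟨ cong (⌊log₂ (suc n) ⌋ +_) (ℕ.+-identityʳ _) ⟨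
  2 * ⌊log₂ (suc n) ⌋                ∎
  where open ℕ.≤-Reasoning

-- v is the number of vertices left in the tree. The 4 is one factor 2 from the logarithm and one
-- from the budget 2mB; the lone B is absorbed because ⌊log₂ k⌋ ≥ 1.
budget+load≤ : ∀ C {k v} B → 2 ≤ k → v ≤ suc k →
               B + C * ⌈log₂ v ⌉ * (2 * B) ≤ (1 + 4 * C) * ⌊log₂ k ⌋ * B
budget+load≤ C {k} {v} B 2≤k v≤1+k = begin
  B + C * ⌈log₂ v ⌉ * (2 * B)
    ≤⟨ ℕ.+-mono-≤ (ℕ.m≤n*m B ℓ {{>-nonZero (⌊log₂⌋-mono-≤ 2≤k)}})
       (ℕ.*-monoˡ-≤ (2 * B) (ℕ.*-monoʳ-≤ C
       (ℕ.≤-trans (⌈log₂⌉-mono-≤ v≤1+k) (⌈log₂[1+n]⌉≤2⌊log₂n⌋ 2≤k)))) ⟩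
  ℓ * B + C * (2 * ℓ) * (2 * B)      ≡⟨ rearrange C ℓ B ⟩
  (1 + 4 * C) * ℓ * B                ∎
  where
  open ℕ.≤-Reasoning
  ℓ = ⌊log₂ k ⌋
  rearrange : ∀ C ℓ B → ℓ * B + C * (2 * ℓ) * (2 * B) ≡ (1 + 4 * C) * ℓ * B
  rearrange = solve-∀

module _ (C : ℕ) {gso : GSOAlgorithm} (approx : IsBicriteriaApproximation (λ v → C * ⌈log₂ v ⌉) 4 gso)
         {k} (2≤k : 2 ≤ k) (I : PCPDS k) where
  open PCPDS I
  open ForestDense gso I
  open RootedTree T using (within)
  open Analysis (λ v → C * ⌈log₂ v ⌉) 4 gso approx I

  approximation : ∀ F → Returns F → ∀ F* → IsPrecedenceClosed F* →
                  density F* ℚ.≤ fromℕ (8 * (1 + 4 * C) * ⌊log₂ k ⌋) ℚ.* density F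
  approximation F (runF , _ , best) F* closed* =
    let i , B≤2L* , w*≤ = matching-budget F* closed* in byWeight i B≤2L* w*≤ (gsoWeight i) refl
    where
    open Run runF
    module F* = Assignment F*
    ratio = fromℕ (8 * (1 + 4 * C) * ⌊log₂ k ⌋)
    M = (1 + 4 * C) * ⌊log₂ k ⌋

    factor : ∀ C ℓ → 4 * ((1 + 4 * C) * ℓ * 2) ≡ 8 * (1 + 4 * C) * ℓ
    factor = solve-∀

    loads : ∀ c m B → c * (2 * m * B) ≡ m * (c * (2 * B))
    loads = solve-∀

    byWeight : ∀ i → fromℕ (B i) ℚ.≤ fromℕ 2 ℚ.* F*.length →
               weight w F*.cov ≤ 4 * gsoWeight i → ∀ x → gsoWeight i ≡ x →
               density F* ℚ.≤ ratio ℚ.* density F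
    -- A tour of covered weight 0 may visit no set, leaving no assignment for this budget; but then
    -- F* has weight 0, and any non-negative bound holds.
    byWeight i _ w*≤ zero eq = p≤c*q⇒p÷q≤c F*.length {{F*.length-nonZero}} F*.length>0
      (ℚ.≤-trans (fromℕ-mono-≤ {weight w F*.cov} {0} (ℕ.≤-trans w*≤ (ℕ.≤-reflexive (cong (4 *_) eq))))
        (0≤p*q (0≤p*q (0≤fromℕ (8 * (1 + 4 * C) * ⌊log₂ k ⌋)) (density≥0 I F)) (ℚ.<⇒≤ F*.length>0)))
    byWeight i B≤2L* w*≤ (suc x) eq = begin
      density F*
        ≤⟨ ÷-mono {r = fromℕ M ℚ.* fromℕ 2} F*.length Fᵢ.length
           {{F*.length-nonZero}} {{Fᵢ.length-nonZero}} F*.length>0 Fᵢ.length>0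
           (0≤fromℕ (weight w Fᵢ.cov)) (0≤fromℕ 4) weights lengths ⟩
      fromℕ 4 ℚ.* (fromℕ M ℚ.* fromℕ 2) ℚ.* density (𝓕 i ne)
        ≡⟨ cong (ℚ._* density (𝓕 i ne)) constants ⟩
      ratio ℚ.* density (𝓕 i ne)
        ≤⟨ ℚ.*-monoˡ-≤-nonNeg ratio {{ℚ.nonNegative (0≤fromℕ (8 * (1 + 4 * C) * ⌊log₂ k ⌋))}} (best i ne) ⟩
      ratio ℚ.* density F                                       ∎
      where
      open ℚ.≤-Reasoning
      ne : Nonempty (collection i)
      ne = gsoWeight>0⇒nonempty i (subst (0 <_) (sym eq) (s≤s z≤n))
      module Fᵢ = Assignment (𝓕 i ne)
      Bᵢ = B i
      V = within Bᵢ

      weights : fromℕ (weight w F*.cov) ℚ.≤ fromℕ 4 ℚ.* fromℕ (weight w Fᵢ.cov)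
      weights = subst (fromℕ (weight w F*.cov) ℚ.≤_) (fromℕ-* 4 (weight w Fᵢ.cov))
        (fromℕ-mono-≤ (ℕ.≤-trans w*≤ (ℕ.*-monoʳ-≤ 4 (gsoWeight≤cov i (listScheduled i ne)))))

      lengths : Fᵢ.length ℚ.≤ fromℕ M ℚ.* fromℕ 2 ℚ.* F*.length
      lengths = begin
        Fᵢ.length
          ≤⟨ listSchedule-length I (listScheduled i ne) (collection-rootDist i)
             (ℕ.≤-trans (collection-cost i) (ℕ.≤-reflexive (loads (C * ⌈log₂ ∣ V ∣ ⌉) m Bᵢ))) ⟩
        fromℕ (Bᵢ + C * ⌈log₂ ∣ V ∣ ⌉ * (2 * Bᵢ))
          ≤⟨ fromℕ-mono-≤ (budget+load≤ C Bᵢ 2≤k (∣p∣≤n V)) ⟩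
        fromℕ (M * Bᵢ)                                          ≡⟨ fromℕ-* M Bᵢ ⟩
        fromℕ M ℚ.* fromℕ Bᵢ
          ≤⟨ ℚ.*-monoˡ-≤-nonNeg (fromℕ M) {{ℚ.nonNegative (0≤fromℕ M)}} B≤2L* ⟩
        fromℕ M ℚ.* (fromℕ 2 ℚ.* F*.length)
          ≡⟨ ℚ.*-assoc (fromℕ M) (fromℕ 2) F*.length ⟨
        fromℕ M ℚ.* fromℕ 2 ℚ.* F*.length                       ∎

      constants : fromℕ 4 ℚ.* (fromℕ M ℚ.* fromℕ 2) ≡ ratio
      constants = trans (cong (fromℕ 4 ℚ.*_) (sym (fromℕ-* M 2)))
        (trans (sym (fromℕ-* 4 (M * 2))) (cong fromℕ (factor C ⌊log₂ k ⌋)))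

theorem5p2 :
  ∀ (C : ℕ) → ∃[ A ] 0 < A ×
    (∀ (gso : GSOAlgorithm) → IsBicriteriaApproximation (λ v → C * ⌈log₂ v ⌉) 4 gso →
     ∀ {k} → 2 ≤ k → (I : PCPDS k) →
     let open PCPDS I
         open ForestDense gso I
     in (∃[ F ] Returns F)
        × (∀ F → Returns F →
             IsPrecedenceClosed F
             × (∀ F* → IsOptimal F* →
                  density F* ℚ.≤ fromℕ (A * ⌊log₂ k ⌋) ℚ.* density F)))
theorem5p2 C = 8 * (1 + 4 * C) , s≤s z≤n , λ gso approx 2≤k I →
  Analysis.returns (λ v → C * ⌈log₂ v ⌉) 4 gso approx I ,
  λ { F ret@(run , (i , ne , refl) , _) →
      listSchedule-closed I (ForestDense.Run.listScheduled run i ne) ,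
      λ F* (closed* , _) → approximation C approx 2≤k I F ret F* closed* }
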